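{- For $2\le k\le n$, we have $$f(n,k,\ell)\ge n\ell.$$ Moreover, the following assertions hold: (i) if $\ell=1$, then $f(n,k,\ell)=n$; (ii) if $2\le \ell\le n-1$, then $f(n,n,\ell)=n\ell$ for $k=n\notin\{4,6\}$; (iii) if $n$ is even and $\ell=n-2$, then $f(n,2,\ell)=n\ell$.
   Context: Digraphs are finite, without loops and without parallel arcs (a pair of opposite arcs $xy$, $yx$ is allowed). A digraph is strong if it is strongly connected. For a digraph $D=(V,A)$ of order $n=|V|$ and a set $S\subseteq V$ with $|S|=k$, $2\le k\le n$, strong subgraphs $D_1,\dots,D_p$ of $D$ containing $S$ are internally disjoint if $V(D_i)\cap V(D_j)=S$ and $A(D_i)\cap A(D_j)=\emptyset$ for all $1\le i<j\le p$. $\kappa_S(D)$ is the maximum number of internally disjoint strong subgraphs of $D$ containing $S$ (it is $0$ if there are none). The strong subgraph $k$-connectivity is $\kappa_k(D)=\min\{\kappa_S(D)\mid S\subseteq V,\ |S|=k\}$. A digraph $D$ is minimally strong subgraph $(k,\ell)$-connected if $\kappa_k(D)\ge \ell$ but $\kappa_k(D-e)\le \ell-1$ for every arc $e\in A(D)$. $\mathfrak{F}(n,k,\ell)$ is the set of all minimally strong subgraph $(k,\ell)$-connected digraphs of order $n$; when this set is nonempty, $f(n,k,\ell)=\min\{|A(D)|\mid D\in\mathfrak{F}(n,k,\ell)\}$. -}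

module Defs where

open import Data.Nat.Base using (ℕ; _≤_; _<_)
open import Data.Fin.Base as Fin using (Fin; zero; suc)
open import Data.Fin.Subset using (Subset; _∈_; _∉_; _⊆_; _∩_; _-_; ∣_∣; ⁅_⁆)
open import Data.Fin.Subset.Properties using (p─q⊆p)
open import Data.Product.Base using (∃-syntax; _×_)
open import Data.Vec.Base using (sum; tabulate)
open import Data.Vec.Functional using (Vector; updateAt)
open import Function.Base using (_∘_)
open import Relation.Binary.Construct.Closure.ReflexiveTransitive using (Star)
open import Relation.Binary.PropositionalEquality.Core using (_≡_)

IsMaximum IsMinimum : (ℕ → Set) → ℕ → Set
IsMaximum P m = P m × (∀ p → P p → p ≤ m)
IsMinimum P m = P m × (∀ p → P p → m ≤ p)

-- Digraphs on the vertex set Fin n; the arcs are the pairs x y with y ∈ out x,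
-- so parallel arcs cannot occur while opposite arcs can.
record Digraph (n : ℕ) : Set where
  field
    out      : Fin n → Subset n
    loopless : ∀ x → x ∉ out x

open Digraph public

numArcs : ∀ {n} → Digraph n → ℕ
numArcs D = sum (tabulate (λ x → ∣ out D x ∣))

updateAt-remove-⊆ : ∀ {n k} (N : Vector (Subset k) n) (x : Fin n) (y : Fin k) (u : Fin n) →
                    updateAt N x (_- y) u ⊆ N u
updateAt-remove-⊆ N zero    y zero    v∈ = p─q⊆p (N zero) ⁅ y ⁆ v∈
updateAt-remove-⊆ N zero    y (suc u) v∈ = v∈
updateAt-remove-⊆ N (suc x) y zero    v∈ = v∈
updateAt-remove-⊆ N (suc x) y (suc u) v∈ = updateAt-remove-⊆ (N ∘ suc) x y u v∈

deleteArc : ∀ {n} → Digraph n → Fin n → Fin n → Digraph n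
deleteArc D x y = record
  { out      = updateAt (out D) x (_- y)
  ; loopless = λ u → loopless D u ∘ updateAt-remove-⊆ (out D) x y u
  }

-- Subgraphs need be neither spanning nor induced.
record Subgraph {n : ℕ} (D : Digraph n) : Set where
  field
    V     : Subset n
    A     : Fin n → Subset n
    arc   : ∀ {x y} → y ∈ A x → y ∈ out D x
    tail∈ : ∀ {x y} → y ∈ A x → x ∈ V
    head∈ : ∀ {x y} → y ∈ A x → y ∈ V

open Subgraph public

Strong : ∀ {n} {D : Digraph n} → Subgraph D → Set
Strong H = ∀ {x y} → x ∈ V H → y ∈ V H → Star (λ u v → v ∈ A H u) x y

InternallyDisjoint : ∀ {n} {D : Digraph n} → Subset n → Subgraph D → Subgraph D → Set
InternallyDisjoint S H K = V H ∩ V K ≡ S × (∀ x y → y ∈ A H x → y ∉ A K x)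

record Packing {n : ℕ} (D : Digraph n) (S : Subset n) (p : ℕ) : Set where
  field
    member   : Fin p → Subgraph D
    strong   : ∀ i → Strong (member i)
    contains : ∀ i → S ⊆ V (member i)
    disjoint : ∀ i j → i Fin.< j → InternallyDisjoint S (member i) (member j)

-- The extremal quantities are given by their graphs: κ⟨ S ⟩ D ≔ m says that
-- κ_S(D) is m, and likewise for κ_k(D) and f(n,k,ℓ).
infix 4 κ⟨_⟩_≔_ κ[_]_≔_ f⟨_,_,_⟩≔_

κ⟨_⟩_≔_ : ∀ {n} → Subset n → Digraph n → ℕ → Set
κ⟨ S ⟩ D ≔ m = IsMaximum (Packing D S) m

κ[_]_≔_ : ∀ {n} → ℕ → Digraph n → ℕ → Set
κ[ k ] D ≔ m = IsMinimum (λ p → ∃[ S ] ∣ S ∣ ≡ k × κ⟨ S ⟩ D ≔ p) m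

-- κ_k(D − e) ≤ ℓ − 1 is written with _<_ to avoid truncated subtraction.
MinimallyConnected : ∀ {n} → ℕ → ℕ → Digraph n → Set
MinimallyConnected k ℓ D =
  (∃[ m ] κ[ k ] D ≔ m × ℓ ≤ m) ×
  (∀ x y → y ∈ out D x → ∃[ m ] κ[ k ] deleteArc D x y ≔ m × m < ℓ)

-- Minima of the empty set do not exist: f⟨ n , k , ℓ ⟩≔ m includes the
-- nonemptiness of the family of minimally connected digraphs.
f⟨_,_,_⟩≔_ : ℕ → ℕ → ℕ → ℕ → Set
f⟨ n , k , ℓ ⟩≔ m =
  IsMinimum (λ a → ∃[ D ] MinimallyConnected {n} k ℓ D × numArcs D ≡ a) m

{-# OPTIONS --safe #-}
-- If S contains x and |S| ≥ 2, then internally disjoint strong subgraphs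
-- containing S leave x by different arcs. So κ_k(D) ≥ ℓ forces all outdegrees to
-- be at least ℓ, and conversely a digraph with all outdegrees ℓ in which every
-- k-set admits ℓ such subgraphs is minimally (k,ℓ)-connected, deletion of an arc
-- destroying at most one member of a packing.
--
-- (i) uses one Hamiltonian cycle, (iii) the complete digraph minus a perfect
-- matching of 2-cycles, and (ii) the union of ℓ cycles of a decomposition of the
-- complete digraph into n − 1 Hamiltonian cycles (Tillson's theorem). For odd n
-- the latter consists of the rotations of a zigzag through ℤ/(n−1), closed up by
-- ∞. For even n ≥ 8, the zigzags on n − 1 vertices admit a Hamiltonian path with
-- one arc in each of them; the last vertex is inserted into each zigzag at that
-- arc, and it closes the path to one more cycle.
module Submission where

open import Defs
open import Data.Fin.Base as Fin using (Fin; zero; suc; punchIn; punchOut; toℕ)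
open import Data.Fin.Permutation.Components using (transpose; transpose-inverse)
import Data.Fin.Properties as Fin
open import Data.Fin.Subset
  using (Subset; inside; outside; _∈_; _∉_; _⊆_; _∩_; _-_; ∣_∣; ⁅_⁆; ⊤)
open import Data.Fin.Subset.Properties
open import Data.Nat.Base as ℕ
  using (ℕ; zero; suc; _+_; _*_; _∸_; _≤_; _<_; z≤n; s≤s; s≤s⁻¹)
open import Data.Nat.Divisibility using (_∣_; divides)
open import Data.Nat.DivMod
  using (_%_; _mod_; m%n<n; m%n%n≡m%n; m<n⇒m%n≡m; [m+n]%n≡m%n; %-distribˡ-+)
import Data.Nat.Properties as ℕ
open import Data.Nat.Tactic.RingSolver using (solve-∀)
open import Data.Product.Base using (∃; ∃-syntax; _×_; _,_; proj₁; proj₂)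
open import Data.Sum.Base using (_⊎_; inj₁; inj₂; [_,_]′; swap)
open import Data.Vec.Base using (_∷_; tabulate; sum; here; there)
open import Data.Vec.Functional.Properties using (updateAt-updates; updateAt-minimal)
open import Data.Vec.Properties using (lookup∘tabulate; []=⇒lookup; lookup⇒[]=)
open import Function.Base using (_∘_; id)
open import Function.Definitions using (Injective)
open import Level using (0ℓ)
open import Relation.Binary.Construct.Closure.ReflexiveTransitive as Star
  using (Star; ε; _◅_; _◅◅_)
open import Relation.Binary.Definitions using (tri<; tri≈; tri>)
open import Relation.Binary.PropositionalEquality
  using (_≡_; _≢_; refl; sym; trans; cong; cong₂; subst; module ≡-Reasoning)
open import Relation.Nullary.Decidable
  using (Dec; yes; no; does; dec-true; _×-dec_; _⊎-dec_; ¬?; decidable-stable)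
open import Relation.Nullary.Negation using (¬_; contradiction)
open import Relation.Unary using (Pred; Decidable)

private variable
  k m n p ℓ : ℕ

-- Finite subsets

⟦_⟧ : {P : Pred (Fin n) 0ℓ} → Decidable P → Subset n
⟦ P? ⟧ = tabulate (does ∘ P?)

∈⟦⟧⁺ : {P : Pred (Fin n) 0ℓ} (P? : Decidable P) {x : Fin n} → P x → x ∈ ⟦ P? ⟧
∈⟦⟧⁺ P? {x} Px =
  lookup⇒[]= x _ (trans (lookup∘tabulate (does ∘ P?) x) (dec-true (P? x) Px))

∈⟦⟧⁻ : {P : Pred (Fin n) 0ℓ} (P? : Decidable P) {x : Fin n} → x ∈ ⟦ P? ⟧ → P x
∈⟦⟧⁻ P? {x} x∈ with P? x | trans (sym (lookup∘tabulate (does ∘ P?) x)) ([]=⇒lookup x∈)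
... | yes Px | _  = Px
... | no  _  | ()

enum : (T : Subset n) → Fin ∣ T ∣ → Fin n
enum (inside  ∷ T) zero    = zero
enum (inside  ∷ T) (suc i) = suc (enum T i)
enum (outside ∷ T) i       = suc (enum T i)

enum-∈ : (T : Subset n) (i : Fin ∣ T ∣) → enum T i ∈ T
enum-∈ (inside  ∷ T) zero    = here
enum-∈ (inside  ∷ T) (suc i) = there (enum-∈ T i)
enum-∈ (outside ∷ T) i       = there (enum-∈ T i)

enum-injective : (T : Subset n) → Injective _≡_ _≡_ (enum T)
enum-injective (inside  ∷ T) {zero}  {zero}  eq = refl
enum-injective (inside  ∷ T) {suc i} {suc j} eq =
  cong suc (enum-injective T (Fin.suc-injective eq))
enum-injective (outside ∷ T) eq = enum-injective T (Fin.suc-injective eq)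

injective⇒≤∣p∣ : (T : Subset n) (f : Fin p → Fin n) → Injective _≡_ _≡_ f →
                 (∀ i → f i ∈ T) → p ≤ ∣ T ∣
injective⇒≤∣p∣ {p = zero}  T f inj f∈ = z≤n
injective⇒≤∣p∣ {p = suc p} T f inj f∈ = ℕ.≤-trans
  (s≤s (injective⇒≤∣p∣ (T - f zero) (f ∘ suc) (Fin.suc-injective ∘ inj)
    (λ i → x∈p∧x≢y⇒x∈p-y (f∈ (suc i)) (Fin.0≢1+n ∘ sym ∘ inj))))
  (x∈p⇒∣p-x∣<∣p∣ (f∈ zero))

-- Choosing one preimage for each element of `T` is injective, because `f` recovers the element from
-- it.
∣image∣≤ : (T : Subset n) (f : Fin m → Fin n) → (∀ {x} → x ∈ T → ∃[ i ] f i ≡ x) → ∣ T ∣ ≤ m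
∣image∣≤ T f onto = Fin.injective⇒≤ λ {i} {j} eq → enum-injective T
  (trans (sym (proj₂ (onto (enum-∈ T i))))
    (trans (cong f eq) (proj₂ (onto (enum-∈ T j)))))

subsetContaining : (x : Fin n) → 1 ≤ k → k ≤ n → ∃[ S ] x ∈ S × ∣ S ∣ ≡ k
subsetContaining {suc n} x 1≤k k≤n with ℕ.m≤n⇒m<n∨m≡n k≤n
-- The full set is split off first. For `k < n` there is room to leave out vertex `zero` and
-- recurse, unless `x` is `zero` itself.
... | inj₂ refl = ⊤ , ∈⊤ , ∣⊤∣≡n _
subsetContaining {suc n} (suc x) 1≤k k≤n | inj₁ (s≤s k≤n′)
  with S , x∈S , eq ← subsetContaining x 1≤k k≤n′ = outside ∷ S , there x∈S , eq
subsetContaining {suc n} {suc zero} zero 1≤k k≤n | inj₁ _ = ⁅ zero ⁆ , here , ∣⁅x⁆∣≡1 {suc n} zero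
subsetContaining {suc (suc n)} {suc (suc k)} zero 1≤k (s≤s k≤n) | inj₁ _
  with S , _ , eq ← subsetContaining zero (s≤s z≤n) k≤n = inside ∷ S , here , cong suc eq

anotherMember : (S : Subset n) → 2 ≤ ∣ S ∣ → (x : Fin n) → ∃[ z ] z ∈ S × x ≢ z
anotherMember S 2≤ x with Fin.any? (λ z → (z ∈? S) ×-dec ¬? (x Fin.≟ z))
... | yes ∃z = ∃z
... | no ∄z = contradiction (ℕ.≤-trans 2≤ (p⊆q⇒∣p∣≤∣q∣ S⊆⁅x⁆))
    (ℕ.<⇒≱ (s≤s (ℕ.≤-reflexive (∣⁅x⁆∣≡1 x))))
  where
  S⊆⁅x⁆ : S ⊆ ⁅ x ⁆
  S⊆⁅x⁆ {z} z∈S with x Fin.≟ z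
  ... | yes refl = x∈⁅x⁆ x
  ... | no  x≢z  = contradiction (z , z∈S , x≢z) ∄z

-- Packings of strong subgraphs

private variable
  D : Digraph n
  S : Subset n

InternallyDisjoint-sym : {H K : Subgraph D} → InternallyDisjoint S H K → InternallyDisjoint S K H
InternallyDisjoint-sym (V∩ , A∩) = trans (∩-comm _ _) V∩ , λ x y y∈ y∈′ → A∩ x y y∈′ y∈

members-disjoint : (𝒫 : Packing D S p) {i j : Fin p} → i ≢ j →
            InternallyDisjoint S (Packing.member 𝒫 i) (Packing.member 𝒫 j)
members-disjoint 𝒫 {i} {j} i≢j with Fin.<-cmp i j
... | tri< i<j _ _ = Packing.disjoint 𝒫 i j i<j
... | tri≈ _ i≡j _ = contradiction i≡j i≢j
... | tri> _ _ j<i = InternallyDisjoint-sym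
    {H = Packing.member 𝒫 j} {K = Packing.member 𝒫 i} (Packing.disjoint 𝒫 j i j<i)

firstStep : {R : Fin n → Fin n → Set} {x z : Fin n} → Star R x z → x ≢ z → ∃ (R x)
firstStep ε         x≢z = contradiction refl x≢z
firstStep (xRv ◅ _) _   = _ , xRv

packing≤outDegree : Packing D S p → 2 ≤ ∣ S ∣ → ∀ {x} → x ∈ S → p ≤ ∣ out D x ∣
packing≤outDegree {D = D} {S = S} 𝒫 2≤ {x} x∈S = injective⇒≤∣p∣ (out D x) next next-injective
  (λ i → arc (member i) (proj₂ (firstArc i)))
  where
  open Packing 𝒫
  firstArc : ∀ i → ∃[ v ] v ∈ A (member i) x
  firstArc i with z , z∈S , x≢z ← anotherMember S 2≤ x =
    firstStep (strong i (contains i x∈S) (contains i z∈S)) x≢z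
  next : Fin _ → Fin _
  next = proj₁ ∘ firstArc
  next-injective : Injective _≡_ _≡_ next
  next-injective {i} {j} eq with i Fin.≟ j
  ... | yes i≡j = i≡j
  ... | no  i≢j = contradiction (proj₂ (firstArc j))
    (subst (_∉ A (member j) x) eq (proj₂ (members-disjoint 𝒫 i≢j) x (next i) (proj₂ (firstArc i))))

out-deleteArc : (D : Digraph n) {x y u v : Fin n} → v ∈ out D u → ¬ (u ≡ x × v ≡ y) →
                v ∈ out (deleteArc D x y) u
out-deleteArc D {x} {y} {u} {v} v∈ uv≢xy with u Fin.≟ x
... | yes refl = subst (v ∈_) (sym (updateAt-updates x (out D)))
                   (x∈p∧x≢y⇒x∈p-y v∈ (λ v≡y → uv≢xy (refl , v≡y)))
... | no  u≢x  = subst (v ∈_) (sym (updateAt-minimal u x (out D) u≢x)) v∈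

-- The deleted arc lies in at most one member, which is dropped.
deleteArc-packing : (x y : Fin n) → Packing D S (suc p) → Packing (deleteArc D x y) S p
deleteArc-packing {D = D} {p = p} x y 𝒫 = record
  { member   = λ j → avoiding (member (punchIn i₀ j)) (avoids j)
  ; strong   = strong ∘ punchIn i₀
  ; contains = contains ∘ punchIn i₀
  ; disjoint = λ i j i<j → members-disjoint 𝒫 (Fin.<⇒≢ i<j ∘ Fin.punchIn-injective i₀ i j)
  }
  where
  open Packing 𝒫
  avoiding : (H : Subgraph D) → y ∉ A H x → Subgraph (deleteArc D x y)
  avoiding H xy∉H = record
    { V     = V H
    ; A     = A H
    ; arc   = λ v∈ → out-deleteArc D (arc H v∈) λ { (refl , refl) → xy∉H v∈ }
    ; tail∈ = tail∈ H
    ; head∈ = head∈ H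
    }
  atMostOne : ∃[ i₀ ] ∀ i → i₀ ≢ i → y ∉ A (member i) x
  atMostOne with Fin.any? (λ i → y ∈? A (member i) x)
  ... | yes (i₀ , y∈) = i₀ , λ i i₀≢i → proj₂ (members-disjoint 𝒫 i₀≢i) x y y∈
  -- No member uses the arc, so any member may be dropped; `zero` is an arbitrary choice.
  ... | no  ∄i        = zero , λ i _ y∈ → ∄i (i , y∈)
  i₀ : Fin (suc p)
  i₀ = proj₁ atMostOne
  avoids : ∀ j → y ∉ A (member (punchIn i₀ j)) x
  avoids j = proj₂ atMostOne _ (Fin.punchInᵢ≢i i₀ j ∘ sym)

-- Extremal values

-- `P` is not assumed decidable, so the maximum is obtained only up to double negation: either the
-- bound is attained, or it can be lowered by one.
¬¬-maximum : (P : ℕ → Set) → P 0 → ∀ b → (∀ q → P q → q ≤ b) → ¬ ¬ ∃ (IsMaximum P)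
¬¬-maximum P P0 zero    bound k = k (0 , P0 , bound)
¬¬-maximum P P0 (suc b) bound k = ¬¬Pb λ Pb → k (suc b , Pb , bound)
  where
  ¬¬Pb : ¬ ¬ P (suc b)
  ¬¬Pb ¬Pb = ¬¬-maximum P P0 b below k
    where
    below : ∀ q → P q → q ≤ b
    below q Pq with ℕ.m≤n⇒m<n∨m≡n (bound q Pq)
    ... | inj₁ q<1+b = s≤s⁻¹ q<1+b
    ... | inj₂ refl  = contradiction Pq ¬Pb

emptyPacking : Packing D S 0
emptyPacking = record { member = λ () ; strong = λ () ; contains = λ () ; disjoint = λ () }

connected⇒outDegree : 2 ≤ k → k ≤ n → (D : Digraph n) → κ[ k ] D ≔ m → ∀ x → m ≤ ∣ out D x ∣
connected⇒outDegree {k = k} {m = m} 2≤k k≤n D (_ , minimal) x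
  with S , x∈S , ∣S∣≡k ← subsetContaining x (ℕ.<⇒≤ 2≤k) k≤n =
  -- The goal is a decidable inequality, so it may be proved under a double negation, where the
  -- maximum defining κ for `S` is available.
  decidable-stable (m ℕ.≤? ∣ out D x ∣) λ m≰ →
  ¬¬-maximum (Packing D S) emptyPacking ∣ out D x ∣ (λ _ → bounded S x∈S ∣S∣≡k)
    λ (p , κS) → m≰ (ℕ.≤-trans (minimal p (S , ∣S∣≡k , κS)) (bounded S x∈S ∣S∣≡k (proj₁ κS)))
  where
  bounded : ∀ S → x ∈ S → ∣ S ∣ ≡ k → ∀ {q} → Packing D S q → q ≤ ∣ out D x ∣
  bounded S x∈S refl 𝒫 = packing≤outDegree 𝒫 2≤k x∈S

*≤sum-tabulate : (f : Fin n → ℕ) → (∀ i → m ≤ f i) → n * m ≤ sum (tabulate f)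
*≤sum-tabulate {zero}  f m≤f = z≤n
*≤sum-tabulate {suc n} f m≤f = ℕ.+-mono-≤ (m≤f zero) (*≤sum-tabulate (f ∘ suc) (m≤f ∘ suc))

sum-tabulate≤* : (f : Fin n → ℕ) → (∀ i → f i ≤ m) → sum (tabulate f) ≤ n * m
sum-tabulate≤* {zero}  f f≤m = z≤n
sum-tabulate≤* {suc n} f f≤m = ℕ.+-mono-≤ (f≤m zero) (sum-tabulate≤* (f ∘ suc) (f≤m ∘ suc))

numArcs-lowerBound : 2 ≤ k → k ≤ n → (D : Digraph n) → MinimallyConnected k ℓ D → n * ℓ ≤ numArcs D
numArcs-lowerBound 2≤k k≤n D ((m , κD , ℓ≤m) , _) =
  *≤sum-tabulate _ λ x → ℕ.≤-trans ℓ≤m (connected⇒outDegree 2≤k k≤n D κD x)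

f-lowerBound : 2 ≤ k → k ≤ n → ∀ {a} → f⟨ n , k , ℓ ⟩≔ a → n * ℓ ≤ a
f-lowerBound 2≤k k≤n ((D , minD , refl) , _) = numArcs-lowerBound 2≤k k≤n D minD

-- A k-set through the vertex `x` of small outdegree has κ exactly `ℓ`: its packing gives one bound
-- and the arcs leaving `x` the other. No other k-set has a smaller value.
κ-exact : 2 ≤ k → k ≤ n → (D : Digraph n) → (∀ S → ∣ S ∣ ≡ k → Packing D S ℓ) →
          (x : Fin n) → ∣ out D x ∣ ≤ ℓ → κ[ k ] D ≔ ℓ
κ-exact {k} 2≤k k≤n D packing x deg≤ℓ with S , x∈S , refl ← subsetContaining x (ℕ.<⇒≤ 2≤k) k≤n =
  (S , refl , packing S refl , λ q 𝒫 → ℕ.≤-trans (packing≤outDegree 𝒫 2≤k x∈S) deg≤ℓ) ,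
  λ { p (T , ∣T∣≡k , _ , max) → max _ (packing T ∣T∣≡k) }

out-deleteArc-< : (D : Digraph n) {x y : Fin n} →
                  y ∈ out D x → ∣ out (deleteArc D x y) x ∣ < ∣ out D x ∣
out-deleteArc-< D {x} {y} y∈ =
  subst (λ N → ∣ N ∣ < ∣ out D x ∣) (sym (updateAt-updates x (out D))) (x∈p⇒∣p-x∣<∣p∣ y∈)

regular⇒minimallyConnected :
  2 ≤ k → k ≤ n → (D : Digraph n) → (∀ x → ∣ out D x ∣ ≤ ℓ) →
  (∀ S → ∣ S ∣ ≡ k → Packing D S ℓ) → MinimallyConnected k ℓ D
regular⇒minimallyConnected {k} {suc n} {ℓ} 2≤k k≤n D deg≤ℓ packing =
  (ℓ , κ-exact 2≤k k≤n D packing zero (deg≤ℓ zero) , ℕ.≤-refl) , deleted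
  where
  deleted : ∀ x y → y ∈ out D x → ∃[ m ] κ[ k ] deleteArc D x y ≔ m × m < ℓ
  deleted x y y∈ = dropMember (ℕ.<-≤-trans (out-deleteArc-< D y∈) (deg≤ℓ x)) packing
    where
    -- `ℓ` is generalised to `p` here so that matching can expose it as a successor. The value of κ
    -- after the deletion is then exactly its predecessor.
    dropMember : ∀ {p} → ∣ out (deleteArc D x y) x ∣ < p → (∀ S → ∣ S ∣ ≡ k → Packing D S p) →
                 ∃[ m ] κ[ k ] deleteArc D x y ≔ m × m < p
    dropMember {suc p} (s≤s deg≤p) packing′ = p ,
      κ-exact 2≤k k≤n (deleteArc D x y) (λ S → deleteArc-packing x y ∘ packing′ S) x deg≤p ,
      ℕ.≤-refl
regular⇒minimallyConnected {n = zero} 2≤k k≤0 = contradiction (ℕ.≤-trans 2≤k k≤0) λ ()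

regular⇒f : 2 ≤ k → k ≤ n → (D : Digraph n) → (∀ x → ∣ out D x ∣ ≤ ℓ) →
            (∀ S → ∣ S ∣ ≡ k → Packing D S ℓ) → f⟨ n , k , ℓ ⟩≔ (n * ℓ)
regular⇒f 2≤k k≤n D deg≤ℓ packing =
  (D , minD , ℕ.≤-antisym (sum-tabulate≤* _ deg≤ℓ) (numArcs-lowerBound 2≤k k≤n D minD)) ,
  λ { a (D′ , minD′ , refl) → numArcs-lowerBound 2≤k k≤n D′ minD′ }
  where minD = regular⇒minimallyConnected 2≤k k≤n D deg≤ℓ packing

-- Hamiltonian cycles as successor functions

infix 4 _⊢_↝_

_⊢_↝_ : (Fin n → Fin n) → Fin n → Fin n → Set
f ⊢ x ↝ y = Star (λ u v → f u ≡ v) x y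

-- On a finite set this makes `f` a permutation with a single orbit, that is, the successor function
-- of a Hamiltonian cycle once there are two vertices.
Cyclic : (Fin n → Fin n) → Set
Cyclic f = ∀ x y → f ⊢ x ↝ y

-- Walks along a function are deterministic, so walks with a common start differ only in length.
-- Comparing the walks from `root` to `x` and back to `root` shows that `x` returns to `root`.
reachable⇒cyclic : (f : Fin n → Fin n) (root last : Fin n) → f last ≡ root →
                   (∀ x → f ⊢ root ↝ x) → Cyclic f
reachable⇒cyclic f root last closes reach x y = back (reach x) ε ◅◅ reach y
  where
  around : f ⊢ f root ↝ root
  around with reach last
  ... | ε         = subst (λ v → f ⊢ v ↝ root) (sym closes) ε
  ... | refl ◅ xs = xs ◅◅ closes ◅ ε
  back : ∀ {u v} → f ⊢ u ↝ v → f ⊢ u ↝ root → f ⊢ v ↝ root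
  back ε           u↝     = u↝
  -- The walk to `root` ends before `v` is met, so it is prolonged by a full turn.
  back (refl ◅ xs) ε      = back xs around
  back (refl ◅ xs) (refl ◅ ys) = back xs ys

cyclic⇒surjective : {f : Fin n → Fin n} → Cyclic f → ∀ y → ∃[ x ] f x ≡ y
cyclic⇒surjective {f = f} cyc y = lastStep refl (cyc (f y) y)
  where
  lastStep : ∀ {u v w} → f u ≡ v → f ⊢ v ↝ w → ∃[ x ] f x ≡ w
  lastStep fu≡v ε         = _ , fu≡v
  lastStep fu≡v (e ◅ vs)  = lastStep e vs

-- A section of the surjection `f` is injective. If `f` identified `a` and `b`, the section would
-- miss one of them and so embed the vertex set into a smaller one.
cyclic⇒injective : {f : Fin n → Fin n} → Cyclic f → Injective _≡_ _≡_ f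
cyclic⇒injective {suc n} {f} cyc {a} {b} fa≡fb with a Fin.≟ b
... | yes a≡b = a≡b
... | no  a≢b = contradiction (Fin.injective⇒≤ missed-injective) ℕ.1+n≰n
  where
  section : Fin (suc n) → Fin (suc n)
  section y = proj₁ (cyclic⇒surjective cyc y)
  f∘section : ∀ y → f (section y) ≡ y
  f∘section y = proj₂ (cyclic⇒surjective cyc y)
  section-image : ∀ {c y} → section y ≡ c → section (f c) ≡ c
  section-image {c} {y} eq = trans (cong section (trans (cong f (sym eq)) (f∘section y))) eq
  missed : ∃[ c ] ∀ y → c ≢ section y
  missed with section (f a) Fin.≟ a
  ... | no  ≢a = a , λ y eq → ≢a (section-image (sym eq))
  ... | yes ≡a = b , λ y eq →
    a≢b (trans (sym ≡a) (trans (cong section fa≡fb) (section-image (sym eq))))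
  missed-injective : Injective _≡_ _≡_ (λ y → Fin.punchOut (proj₂ missed y))
  missed-injective {x} {y} eq = trans (sym (f∘section x)) (trans (cong f
    (Fin.punchOut-injective (proj₂ missed x) (proj₂ missed y) eq)) (f∘section y))

insertAfter : (t : Fin n) → (Fin n → Fin n) → Fin (suc n) → Fin (suc n)
insertAfter t f zero    = suc (f t)
insertAfter t f (suc x) with x Fin.≟ t
... | yes _ = zero
... | no  _ = suc (f x)

insertAfter-t : (t : Fin n) (f : Fin n → Fin n) → insertAfter t f (suc t) ≡ zero
insertAfter-t t f with t Fin.≟ t
... | yes _   = refl
... | no  t≢t = contradiction refl t≢t

-- Old walks lift: every old arc survives, except that the one leaving `t` is subdivided by the new
-- vertex.
insertAfter-cyclic : (t : Fin n) {f : Fin n → Fin n} → Cyclic f → Cyclic (insertAfter t f)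
insertAfter-cyclic t {f} cyc = walk
  where
  step : ∀ x → insertAfter t f ⊢ suc x ↝ suc (f x)
  step x with x Fin.≟ t in eq
  ... | yes refl = insertAfter-t t f ◅ refl ◅ ε
  ... | no  x≢t  = unchanged ◅ ε
    where
    unchanged : insertAfter t f (suc x) ≡ suc (f x)
    unchanged rewrite eq = refl
  lift : ∀ {x y} → f ⊢ x ↝ y → insertAfter t f ⊢ suc x ↝ suc y
  lift ε           = ε
  lift (refl ◅ xs) = step _ ◅◅ lift xs
  walk : Cyclic (insertAfter t f)
  walk (suc x) (suc y) = lift (cyc x y)
  walk (suc x) zero    = lift (cyc x t) ◅◅ insertAfter-t t f ◅ ε
  walk zero    (suc y) = refl ◅ lift (cyc (f t) y)
  walk zero    zero    = ε

cyclicPermutation : ∀ n → ∃ (Cyclic {suc n})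
cyclicPermutation zero    = id , λ { zero zero → ε }
cyclicPermutation (suc n) with f , cyc ← cyclicPermutation n =
  insertAfter zero f , insertAfter-cyclic zero cyc

-- A walk starting at a fixed point never leaves it, so it could not reach a second vertex.
cyclic⇒loopless : 2 ≤ n → {f : Fin n → Fin n} → Cyclic f → ∀ x → f x ≢ x
cyclic⇒loopless {n} 2≤n {f} cyc x fx≡x
  with z , _ , x≢z ← anotherMember ⊤ (subst (2 ≤_) (sym (∣⊤∣≡n n)) 2≤n) x = x≢z (stuck (cyc x z))
  where
  stuck : ∀ {z} → f ⊢ x ↝ z → x ≡ z
  stuck ε = refl
  stuck (fx≡y ◅ xs) with refl ← trans (sym fx≡x) fx≡y = stuck xs

-- Arc-disjoint Hamiltonian cycles and their unions

record DisjointCycles (n ℓ : ℕ) : Set where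
  field
    next     : Fin ℓ → Fin n → Fin n
    cyclic   : ∀ i → Cyclic (next i)
    distinct : ∀ x → Injective _≡_ _≡_ (λ i → next i x)

open DisjointCycles

-- A new vertex is inserted into cycle ρ x of 𝒞 after tail x; the arcs which this
-- removes, together with two arcs at the new vertex, form one more cycle.
module Extend
  (𝒞 : DisjointCycles n m)
  (tail : Fin m → Fin n) (tail-injective : Injective _≡_ _≡_ tail)
  (ρ : Fin m → Fin m) (ρ-injective : Injective _≡_ _≡_ ρ)
  (transversal : Fin (suc n) → Fin (suc n)) (transversal-cyclic : Cyclic transversal)
  (transversal-tail : ∀ x → transversal (suc (tail x)) ≡ suc (next 𝒞 (ρ x) (tail x)))
  (tail-or-last : ∀ v → (∃[ x ] tail x ≡ v) ⊎ transversal (suc v) ≡ zero)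
  where

  extendedNext : Fin (suc m) → Fin (suc n) → Fin (suc n)
  extendedNext zero    = transversal
  extendedNext (suc x) = insertAfter (tail x) (next 𝒞 (ρ x))

  transversal-injective : Injective _≡_ _≡_ transversal
  transversal-injective = cyclic⇒injective transversal-cyclic

  -- At the new vertex, equality would give one head two tails on the transversal. At `tail z` the
  -- transversal follows cycle `ρ z`, whose arc there has been subdivided, and the other cycles have
  -- other heads. The last vertex goes to the new one, which inserted cycles enter only from tails.
  transversal≢inserted : ∀ x v → transversal v ≢ extendedNext (suc x) v
  transversal≢inserted x zero    eq =
    Fin.0≢1+n (transversal-injective (trans eq (sym (transversal-tail x))))
  transversal≢inserted x (suc v) eq with tail-or-last v | v Fin.≟ tail x
  ... | inj₁ (z , refl) | yes _   = Fin.0≢1+n (trans (sym eq) (transversal-tail z))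
  ... | inj₁ (z , refl) | no  z≢x = z≢x (cong tail (ρ-injective (distinct 𝒞 (tail z)
    (Fin.suc-injective (trans (sym (transversal-tail z)) eq)))))
  ... | inj₂ last       | no  _   = Fin.0≢1+n (trans (sym last) eq)
  ... | inj₂ last       | yes refl = Fin.0≢1+n (trans (sym last) (transversal-tail x))

  extendedNext-distinct : ∀ v → Injective _≡_ _≡_ (λ i → extendedNext i v)
  extendedNext-distinct v {zero}  {zero}  _  = refl
  extendedNext-distinct v {zero}  {suc x} eq = contradiction eq (transversal≢inserted x v)
  extendedNext-distinct v {suc x} {zero}  eq = contradiction (sym eq) (transversal≢inserted x v)
  -- The arcs leaving the new vertex end at the heads of the removed arcs; the transversal contains
  -- these arcs, so distinct tails have distinct heads.
  extendedNext-distinct zero {suc x} {suc y} eq = cong suc (tail-injective (Fin.suc-injective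
    (transversal-injective (trans (transversal-tail x) (trans eq (sym (transversal-tail y)))))))
  extendedNext-distinct (suc v) {suc x} {suc y} eq with v Fin.≟ tail x | v Fin.≟ tail y
  ... | yes v≡x | yes v≡y = cong suc (tail-injective (trans (sym v≡x) v≡y))
  ... | yes _   | no  _   = contradiction eq λ ()
  ... | no  _   | yes _   = contradiction eq λ ()
  ... | no  _   | no  _   = cong suc (ρ-injective (distinct 𝒞 v (Fin.suc-injective eq)))

  extendedCycles : DisjointCycles (suc n) (suc m)
  extendedCycles = record
    { next     = extendedNext
    ; cyclic   = λ { zero    → transversal-cyclic
                   ; (suc x) → insertAfter-cyclic (tail x) (cyclic 𝒞 (ρ x)) }
    ; distinct = extendedNext-distinct
    }

takeCycles : ℓ ≤ m → DisjointCycles n m → DisjointCycles n ℓ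
takeCycles ℓ≤m 𝒞 = record
  { next     = next 𝒞 ∘ inj
  ; cyclic   = cyclic 𝒞 ∘ inj
  ; distinct = λ x eq → Fin.inject≤-injective ℓ≤m ℓ≤m _ _ (distinct 𝒞 x eq)
  }
  where inj = λ i → Fin.inject≤ i ℓ≤m

module Union (2≤n : 2 ≤ n) (𝒞 : DisjointCycles n ℓ) where

  isNext? : ∀ x y → Dec (∃[ i ] next 𝒞 i x ≡ y)
  isNext? x y = Fin.any? λ i → next 𝒞 i x Fin.≟ y

  union : Digraph n
  union = record
    { out      = λ x → ⟦ isNext? x ⟧
    ; loopless = λ x x∈ → let i , eq = ∈⟦⟧⁻ (isNext? x) x∈ in
                          cyclic⇒loopless 2≤n (cyclic 𝒞 i) x eq
    }

  outDegree≤ : ∀ x → ∣ out union x ∣ ≤ ℓ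
  outDegree≤ x = ∣image∣≤ (out union x) (λ i → next 𝒞 i x) (∈⟦⟧⁻ (isNext? x))

  cycle : Fin ℓ → Subgraph union
  cycle i = record
    { V     = ⊤
    ; A     = λ x → ⁅ next 𝒞 i x ⁆
    ; arc   = λ {x} y∈ → ∈⟦⟧⁺ (isNext? x) (i , sym (x∈⁅y⁆⇒x≡y _ y∈))
    ; tail∈ = λ _ → ∈⊤
    ; head∈ = λ _ → ∈⊤
    }

  -- Spanning members meet in all vertices, which forces `S` to be the whole vertex set once there
  -- are two of them. Asking for this only at pairs `i < j` lets a single cycle serve every `S`.
  packing : (S : Subset n) → (∀ (i j : Fin ℓ) → i Fin.< j → ⊤ ≡ S) → Packing union S ℓ
  packing S ⊤≡S = record
    { member   = cycle
    ; strong   = λ i {x} {y} _ _ → Star.map (λ { refl → x∈⁅x⁆ _ }) (cyclic 𝒞 i x y)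
    ; contains = λ _ _ → ∈⊤
    ; disjoint = λ i j i<j → trans (∩-idem ⊤) (⊤≡S i j i<j) , λ x y y∈ y∈′ →
        Fin.<⇒≢ i<j (distinct 𝒞 x (trans (sym (x∈⁅y⁆⇒x≡y _ y∈)) (x∈⁅y⁆⇒x≡y _ y∈′)))
    }

f-spanning : 2 ≤ n → DisjointCycles n ℓ → f⟨ n , n , ℓ ⟩≔ (n * ℓ)
f-spanning 2≤n 𝒞 = regular⇒f 2≤n ℕ.≤-refl union outDegree≤
  λ S ∣S∣≡n → packing S λ _ _ _ → sym (∣p∣≡n⇒p≡⊤ ∣S∣≡n)
  where open Union 2≤n 𝒞

f-one : 2 ≤ k → k ≤ n → f⟨ n , k , 1 ⟩≔ n
f-one {k} {n} 2≤k k≤n = subst (f⟨ n , k , 1 ⟩≔_) (ℕ.*-identityʳ n)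
  (regular⇒f 2≤k k≤n union outDegree≤ λ S _ → packing S λ { zero zero () })
  where
  oneCycle : 2 ≤ n → DisjointCycles n 1
  oneCycle (s≤s _) with f , cyc ← cyclicPermutation _ = record
    { next     = λ _ → f
    ; cyclic   = λ _ → cyc
    ; distinct = λ { _ {zero} {zero} _ → refl }
    }
  open Union (ℕ.≤-trans 2≤k k≤n) (oneCycle (ℕ.≤-trans 2≤k k≤n))

-- Odd order: rotated zigzags

m+m≡n+n⇒m≡n : ∀ m n → m + m ≡ n + n → m ≡ n
m+m≡n+n⇒m≡n m n eq with ℕ.<-cmp m n
... | tri< m<n _ _ = contradiction eq (ℕ.<⇒≢ (ℕ.+-mono-< m<n m<n))
... | tri≈ _ m≡n _ = m≡n
... | tri> _ _ n<m = contradiction (sym eq) (ℕ.<⇒≢ (ℕ.+-mono-< n<m n<m))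

1+m+m≢n+n : ∀ m n → suc (m + m) ≢ n + n
1+m+m≢n+n m       zero    ()
1+m+m≢n+n zero    (suc n) eq = contradiction (trans (ℕ.suc-injective eq) (ℕ.+-suc n n)) λ ()
1+m+m≢n+n (suc m) (suc n) eq = 1+m+m≢n+n m n
  (trans (sym (ℕ.+-suc m m)) (ℕ.suc-injective (trans (ℕ.suc-injective eq) (ℕ.+-suc n n))))

parity : ∀ n → ∃[ j ] (n ≡ j + j ⊎ n ≡ suc (j + j))
parity zero          = 0 , inj₁ refl
parity (suc zero)    = 0 , inj₂ refl
parity (suc (suc n)) with parity n
... | j , inj₁ refl = suc j , inj₁ (cong suc (sym (ℕ.+-suc j j)))
... | j , inj₂ refl = suc j , inj₂ (cong (2 +_) (sym (ℕ.+-suc j j)))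

module Zigzag (h′ : ℕ) where

  h N : ℕ
  h = suc h′
  N = h + h

  h<N : h < N
  h<N = ℕ.m<m+n h (s≤s z≤n)

  -- Residues are kept from unfolding, so they are compared only through `toℕ-[]`.
  abstract

    [_] : ℕ → Fin N
    [ a ] = a mod N

    toℕ-[] : ∀ a → toℕ [ a ] ≡ a % N
    toℕ-[] a = Fin.toℕ-fromℕ< (m%n<n a N)

  []-cong : ∀ a b → a % N ≡ b % N → [ a ] ≡ [ b ]
  []-cong a b eq = Fin.toℕ-injective (trans (toℕ-[] a) (trans eq (sym (toℕ-[] b))))

  []-injective : ∀ {a b} → a < N → b < N → [ a ] ≡ [ b ] → a ≡ b
  []-injective {a} {b} a<N b<N eq = begin
    a          ≡⟨ m<n⇒m%n≡m a<N ⟨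
    a % N      ≡⟨ toℕ-[] a ⟨
    toℕ [ a ]  ≡⟨ cong toℕ eq ⟩
    toℕ [ b ]  ≡⟨ toℕ-[] b ⟩
    b % N      ≡⟨ m<n⇒m%n≡m b<N ⟩
    b          ∎
    where open ≡-Reasoning

  [toℕ] : ∀ x → [ toℕ x ] ≡ x
  [toℕ] x = Fin.toℕ-injective (trans (toℕ-[] (toℕ x)) (m<n⇒m%n≡m (Fin.toℕ<n x)))

  [+N] : ∀ a → [ a + N ] ≡ [ a ]
  [+N] a = []-cong (a + N) a ([m+n]%n≡m%n a N)

  infixl 6 _⊕_ _⊖_

  _⊕_ : Fin N → ℕ → Fin N
  x ⊕ a = [ toℕ x + a ]

  []⊕ : ∀ a b → [ a ] ⊕ b ≡ [ a + b ]
  []⊕ a b = []-cong (toℕ [ a ] + b) (a + b) (begin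
    (toℕ [ a ] + b) % N          ≡⟨ cong (λ c → (c + b) % N) (toℕ-[] a) ⟩
    (a % N + b) % N              ≡⟨ %-distribˡ-+ (a % N) b N ⟩
    (a % N % N + b % N) % N      ≡⟨ cong (λ c → (c + b % N) % N) (m%n%n≡m%n a N) ⟩
    (a % N + b % N) % N          ≡⟨ %-distribˡ-+ a b N ⟨
    (a + b) % N                  ∎)
    where open ≡-Reasoning

  ⊕-assoc : ∀ x a b → x ⊕ a ⊕ b ≡ x ⊕ (a + b)
  ⊕-assoc x a b = trans ([]⊕ (toℕ x + a) b) (cong [_] (ℕ.+-assoc (toℕ x) a b))

  ⊕-identityʳ : ∀ x → x ⊕ 0 ≡ x
  ⊕-identityʳ x = trans (cong [_] (ℕ.+-identityʳ (toℕ x))) ([toℕ] x)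

  ⊕N : ∀ x → x ⊕ N ≡ x
  ⊕N x = trans ([+N] (toℕ x)) ([toℕ] x)

  ⊕-cancelʳ : ∀ {x y} a → a ≤ N → x ⊕ a ≡ y ⊕ a → x ≡ y
  ⊕-cancelʳ {x} {y} a a≤N eq = trans (sym (undo x)) (trans (cong (_⊕ (N ∸ a)) eq) (undo y))
    where
    undo : ∀ z → z ⊕ a ⊕ (N ∸ a) ≡ z
    undo z = trans (⊕-assoc z a (N ∸ a)) (trans (cong (z ⊕_) (ℕ.m+[n∸m]≡n a≤N)) (⊕N z))

  ⊕-cancelˡ : ∀ x {a b} → a < N → b < N → x ⊕ a ≡ x ⊕ b → a ≡ b
  ⊕-cancelˡ x {a} {b} a<N b<N eq = []-injective a<N b<N
    (trans (sym (undo a)) (trans (cong (_⊕ (N ∸ toℕ x)) eq) (undo b)))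
    where
    undo : ∀ c → x ⊕ c ⊕ (N ∸ toℕ x) ≡ [ c ]
    undo c = begin
      x ⊕ c ⊕ (N ∸ toℕ x)            ≡⟨ []⊕ (toℕ x + c) (N ∸ toℕ x) ⟩
      [ toℕ x + c + (N ∸ toℕ x) ]    ≡⟨ cong (λ d → [ d + (N ∸ toℕ x) ]) (ℕ.+-comm (toℕ x) c) ⟩
      [ c + toℕ x + (N ∸ toℕ x) ]    ≡⟨ cong [_] (ℕ.+-assoc c (toℕ x) (N ∸ toℕ x)) ⟩
      [ c + (toℕ x + (N ∸ toℕ x)) ]  ≡⟨ cong (λ d → [ c + d ]) (ℕ.m+[n∸m]≡n (Fin.toℕ≤n x)) ⟩
      [ c + N ]                      ≡⟨ [+N] c ⟩
      [ c ]                          ∎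
      where open ≡-Reasoning

  -- The position of `x` relative to `r`: the representative of x - r below `N`.
  _⊖_ : Fin N → Fin N → ℕ
  x ⊖ r = (toℕ x + (N ∸ toℕ r)) % N

  ⊖<N : ∀ x r → x ⊖ r < N
  ⊖<N x r = m%n<n (toℕ x + (N ∸ toℕ r)) N

  ⊕-⊖ : ∀ r x → r ⊕ (x ⊖ r) ≡ x
  ⊕-⊖ r x = begin
    [ toℕ r + d % N ]              ≡⟨ cong [_] (ℕ.+-comm (toℕ r) (d % N)) ⟩
    [ d % N + toℕ r ]              ≡⟨ cong (λ c → [ c + toℕ r ]) (toℕ-[] d) ⟨
    [ d ] ⊕ toℕ r                  ≡⟨ []⊕ d (toℕ r) ⟩
    [ d + toℕ r ]                  ≡⟨ cong [_] (ℕ.+-assoc (toℕ x) (N ∸ toℕ r) (toℕ r)) ⟩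
    x ⊕ (N ∸ toℕ r + toℕ r)        ≡⟨ cong (x ⊕_) (ℕ.m∸n+n≡m (Fin.toℕ≤n r)) ⟩
    x ⊕ N                          ≡⟨ ⊕N x ⟩
    x                              ∎
    where
    open ≡-Reasoning
    d = toℕ x + (N ∸ toℕ r)

  ⊖-⊕ : ∀ r {y} → y < N → r ⊕ y ⊖ r ≡ y
  ⊖-⊕ r y<N = ⊕-cancelˡ r (⊖<N (r ⊕ _) r) y<N (⊕-⊖ r (r ⊕ _))

  -- The vertices are ∞ = zero and the residues suc x. Cycle r runs through
  -- ∞, r, r−1, r+1, r−2, r+2, …, r+h and back to ∞.
  hop : Fin N → ℕ → Fin (suc N)
  hop r y with ℕ.<-cmp y h
  ... | tri< _ _ _ = suc (r ⊕ (N ∸ suc y))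
  ... | tri≈ _ _ _ = zero
  ... | tri> _ _ _ = suc (r ⊕ (N ∸ y))

  zigzag : Fin N → Fin (suc N) → Fin (suc N)
  zigzag r zero    = suc r
  zigzag r (suc x) = hop r (x ⊖ r)

  -- In this lemma and in `zigzag-high` the target position `z` is fixed by an equation, so that
  -- callers may supply it in any form instead of as a truncated difference.
  zigzag-low : ∀ r {y z} → y < h → y + suc z ≡ N → zigzag r (suc (r ⊕ y)) ≡ suc (r ⊕ z)
  zigzag-low r {y} {z} y<h y+1+z≡N rewrite ⊖-⊕ r (ℕ.<-trans y<h h<N) with ℕ.<-cmp y h
  ... | tri< _ _ _   = cong (λ d → suc (r ⊕ d)) (trans
    (cong (_∸ suc y) (trans (sym y+1+z≡N) (ℕ.+-suc y z))) (ℕ.m+n∸m≡n (suc y) z))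
  ... | tri≈ y≮h _ _ = contradiction y<h y≮h
  ... | tri> y≮h _ _ = contradiction y<h y≮h

  zigzag-mid : ∀ r → zigzag r (suc (r ⊕ h)) ≡ zero
  zigzag-mid r rewrite ⊖-⊕ r h<N with ℕ.<-cmp h h
  ... | tri< _ h≢h _ = contradiction refl h≢h
  ... | tri≈ _ _ _   = refl
  ... | tri> _ h≢h _ = contradiction refl h≢h

  zigzag-high : ∀ r {y z} → h < y → y < N → y + z ≡ N → zigzag r (suc (r ⊕ y)) ≡ suc (r ⊕ z)
  zigzag-high r {y} {z} h<y y<N y+z≡N rewrite ⊖-⊕ r y<N with ℕ.<-cmp y h
  ... | tri< _ _ y≯h = contradiction h<y y≯h
  ... | tri≈ _ _ y≯h = contradiction h<y y≯h
  ... | tri> _ _ _   = cong (λ d → suc (r ⊕ d)) (trans (cong (_∸ y) (sym y+z≡N)) (ℕ.m+n∸m≡n y z))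

  zigzag-cyclic : ∀ r → Cyclic (zigzag r)
  zigzag-cyclic r = reachable⇒cyclic (zigzag r) zero (suc (r ⊕ h)) (zigzag-mid r) reach
    where
    -- Two arcs lead from position i through N - 1 - i to position i + 1.
    ascend : ∀ i → i < h → zigzag r ⊢ zero ↝ suc (r ⊕ i)
    ascend zero    _     = cong suc (sym (⊕-identityʳ r)) ◅ ε
    ascend (suc i) 1+i<h = ascend i (ℕ.<⇒≤ 1+i<h) ◅◅
      zigzag-low r (ℕ.<⇒≤ 1+i<h) i+1+z≡N ◅ zigzag-high r h<z z<N z+1+i≡N ◅ ε
      where
      z = N ∸ suc i
      1+i≤N : suc i ≤ N
      1+i≤N = ℕ.<⇒≤ (ℕ.<-trans 1+i<h h<N)
      z+1+i≡N : z + suc i ≡ N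
      z+1+i≡N = ℕ.m∸n+n≡m 1+i≤N
      i+1+z≡N : i + suc z ≡ N
      i+1+z≡N = trans (ℕ.+-suc i z) (ℕ.m+[n∸m]≡n 1+i≤N)
      h<z : h < z
      h<z = ℕ.+-cancelʳ-< (suc i) h z (subst (h + suc i <_) (sym z+1+i≡N) (ℕ.+-monoʳ-< h 1+i<h))
      z<N : z < N
      z<N = subst (z <_) z+1+i≡N (ℕ.m<m+n z (s≤s z≤n))
    reach : ∀ x → zigzag r ⊢ zero ↝ x
    reach zero    = ε
    reach (suc x) with x ⊖ r | ⊖<N x r | ⊕-⊖ r x
    ... | y | y<N | refl with y ℕ.<? h
    ... | yes y<h = ascend y y<h
    -- A position from `h` on is the target of the low arc leaving its mirror image N - 1 - y.
    ... | no  y≮h = ascend i i<h ◅◅ zigzag-low r i<h (ℕ.m∸n+n≡m y<N) ◅ ε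
      where
      i = N ∸ suc y
      i<h : i < h
      i<h = ℕ.+-cancelʳ-< (suc y) i h (subst (_< h + suc y) (sym (ℕ.m∸n+n≡m y<N))
        (ℕ.+-monoʳ-< h (s≤s (ℕ.≮⇒≥ y≮h))))

  -- The rotation-invariant displacement of each arc. Its parity tells on which
  -- side of the centre the tail lies, and its value then determines the tail.
  data Displacement (x : Fin N) : ℕ → Fin (suc N) → Set where
    low  : ∀ {y} e → e + suc y ≡ h → Displacement x y (suc (x ⊕ suc (e + e)))
    mid  : Displacement x h zero
    high : ∀ {y} e → e < h → e + y ≡ N → Displacement x y (suc (x ⊕ (e + e)))

  displacement : ∀ r y → y < N → Displacement (r ⊕ y) y (hop r y)
  displacement r y y<N with ℕ.<-cmp y h
  ... | tri≈ _ refl _ = mid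
  ... | tri< y<h _ _  = subst (λ v → Displacement (r ⊕ y) y (suc v)) (begin
    r ⊕ y ⊕ suc (e + e)    ≡⟨ ⊕-assoc r y (suc (e + e)) ⟩
    -- After adding `suc y`, both sides equal `N`, being twice `h`.
    r ⊕ (y + suc (e + e))  ≡⟨ cong (r ⊕_) (ℕ.+-cancelʳ-≡ (suc y) _ _ (trans
                                (rearrange y e)
                                (trans (cong (λ c → c + c) e+1+y≡h) (sym (ℕ.m∸n+n≡m y<N))))) ⟩
    r ⊕ (N ∸ suc y)        ∎) (low e e+1+y≡h)
    where
    open ≡-Reasoning
    e = h ∸ suc y
    e+1+y≡h : e + suc y ≡ h
    e+1+y≡h = ℕ.m∸n+n≡m y<h
    rearrange : ∀ y e → y + suc (e + e) + suc y ≡ (e + suc y) + (e + suc y)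
    rearrange = solve-∀
  ... | tri> _ _ h<y  = subst (λ v → Displacement (r ⊕ y) y (suc v)) (begin
    r ⊕ y ⊕ (e + e)    ≡⟨ ⊕-assoc r y (e + e) ⟩
    -- The displacement overshoots the target position `e` by exactly `N`.
    r ⊕ (y + (e + e))  ≡⟨ cong (r ⊕_) (trans (rearrange y e) (cong (e +_) e+y≡N)) ⟩
    r ⊕ (e + N)        ≡⟨ ⊕-assoc r e N ⟨
    r ⊕ e ⊕ N          ≡⟨ ⊕N (r ⊕ e) ⟩
    r ⊕ e              ∎) (high e e<h e+y≡N)
    where
    open ≡-Reasoning
    e = N ∸ y
    e+y≡N : e + y ≡ N
    e+y≡N = ℕ.m∸n+n≡m (ℕ.<⇒≤ y<N)
    e<h : e < h
    e<h = ℕ.+-cancelʳ-< y e h (subst (_< h + y) (sym e+y≡N) (ℕ.+-monoʳ-< h h<y))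
    rearrange : ∀ y e → y + (e + e) ≡ e + (e + y)
    rearrange = solve-∀

  -- All displacements between residues are below `N`, so equal heads give equal numbers. An odd and
  -- an even one never agree, and halving recovers `e`, hence the position.
  displacement-injective : ∀ {x y y′ v v′} →
                           Displacement x y v → Displacement x y′ v′ → v ≡ v′ → y ≡ y′
  displacement-injective {x} = λ
    { (low e p)      (low e′ p′)       eq → ℕ.suc-injective (ℕ.+-cancelˡ-≡ e _ _ (trans p
        (trans (sym p′) (cong (_+ _) (sym (m+m≡n+n⇒m≡n e e′
          (ℕ.suc-injective (⊕-cancelˡ x (odd<N e p) (odd<N e′ p′) (Fin.suc-injective eq)))))))))
    ; (low e p)      (high e′ e′<h p′) eq → contradiction
        (⊕-cancelˡ x (odd<N e p) (even<N e′<h) (Fin.suc-injective eq)) (1+m+m≢n+n e e′)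
    ; (high e e<h p) (low e′ p′)       eq → contradiction
        (⊕-cancelˡ x (odd<N e′ p′) (even<N e<h) (Fin.suc-injective (sym eq))) (1+m+m≢n+n e′ e)
    ; (high e e<h p) (high e′ e′<h p′) eq → ℕ.+-cancelˡ-≡ e _ _ (trans p
        (trans (sym p′) (cong (_+ _) (sym (m+m≡n+n⇒m≡n e e′
          (⊕-cancelˡ x (even<N e<h) (even<N e′<h) (Fin.suc-injective eq)))))))
    ; mid            mid               eq → refl
    }
    where
    even<N : ∀ {e} → e < h → e + e < N
    even<N e<h = ℕ.+-mono-< e<h e<h
    odd<N : ∀ e {y} → e + suc y ≡ h → suc (e + e) < N
    odd<N e {y} p = ℕ.+-mono-≤-< e<h e<h
      where
      e<h : e < h
      e<h = subst (e <_) p (ℕ.m<m+n e (s≤s z≤n))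

  -- Equal successors of `x` force equal positions of `x` relative to `r` and `s`, hence `r ≡ s`. At
  -- ∞ the successor is the index itself.
  zigzag-distinct : ∀ v → Injective _≡_ _≡_ (λ r → zigzag r v)
  zigzag-distinct zero    eq = Fin.suc-injective eq
  zigzag-distinct (suc x) {r} {s} eq = ⊕-cancelʳ (x ⊖ r) (ℕ.<⇒≤ (⊖<N x r))
    (trans (⊕-⊖ r x) (trans (sym (⊕-⊖ s x)) (cong (s ⊕_) (sym y≡y′))))
    where
    at : ∀ r → Displacement x (x ⊖ r) (hop r (x ⊖ r))
    at r = subst (λ z → Displacement z (x ⊖ r) (hop r (x ⊖ r))) (⊕-⊖ r x)
      (displacement r (x ⊖ r) (⊖<N x r))
    y≡y′ : x ⊖ r ≡ x ⊖ s
    y≡y′ = displacement-injective (at r) (at s) eq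

  zigzags : DisjointCycles (suc N) N
  zigzags = record { next = zigzag ; cyclic = zigzag-cyclic ; distinct = zigzag-distinct }

-- Even order: a transversal of the zigzags

transpose-source : (i j : Fin n) → transpose i j i ≡ j
transpose-source i j with i Fin.≟ i
... | yes _   = refl
... | no  i≢i = contradiction refl i≢i

transpose-target : (i j : Fin n) → transpose i j j ≡ i
transpose-target i j with j Fin.≟ i
... | yes j≡i = j≡i
... | no  _ with j Fin.≟ j
...   | yes _   = refl
...   | no  j≢j = contradiction refl j≢j

transpose-other : {i j k : Fin n} → k ≢ i → k ≢ j → transpose i j k ≡ k
transpose-other {i = i} {j} {k} k≢i k≢j with k Fin.≟ i
... | yes k≡i = contradiction k≡i k≢i
... | no  _ with k Fin.≟ j
...   | yes k≡j = contradiction k≡j k≢j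
...   | no  _   = refl

transpose-injective : (i j : Fin n) → Injective _≡_ _≡_ (transpose i j)
transpose-injective i j eq =
  trans (sym (transpose-inverse j i)) (trans (cong (transpose j i) eq) (transpose-inverse j i))

module Transversal (k : ℕ) where

  -- Here h = 3 + k and N = 6 + 2k, so the extended order N + 2 runs through the even numbers from 8
  -- on, and 0, 1, 2, 1 + h, 2 + h are distinct and below `N`.
  open Zigzag (2 + k)

  0<N : 0 < N
  0<N = s≤s z≤n

  1<N : 1 < N
  1<N = s≤s (s≤s z≤n)

  2<N : 2 < N
  2<N = s≤s (s≤s (s≤s z≤n))

  1+h<N : 1 + h < N
  1+h<N = ℕ.+-monoˡ-< h {1} {h} (s≤s (s≤s z≤n))

  2+h<N : 2 + h < N
  2+h<N = ℕ.+-monoˡ-< h {2} {h} (s≤s (s≤s (s≤s z≤n)))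

  []-≢ : ∀ {a b} → a < N → b < N → a ≢ b → [ a ] ≢ [ b ]
  []-≢ {a} {b} a<N b<N a≢b eq = a≢b ([]-injective {a} {b} a<N b<N eq)

  -- Up to finitely many exceptions, the arc from x in the transversal is
  -- x → x + 2, which lies in zigzag x + 1. The exceptions are h → ∞, 0 → 1,
  -- 1 → 2, h+1 → h+2 and −1 → 3; they use the same zigzags, permuted by σ.
  σ : Fin N → Fin N
  σ = transpose [ 2 ] [ 2 + h ] ∘ transpose [ 0 ] [ 1 + h ] ∘ transpose [ 0 ] [ 1 ]

  σ-injective : Injective _≡_ _≡_ σ
  σ-injective = transpose-injective [ 0 ] [ 1 ] ∘ transpose-injective [ 0 ] [ 1 + h ] ∘
    transpose-injective [ 2 ] [ 2 + h ]

  -- Altogether `σ` is the 3-cycle 0 → 1 → 1 + h → 0 times the exchange of 2 and 2 + h; the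
  -- following lemmas tabulate it.
  σ-1 : σ [ 1 ] ≡ [ 1 + h ]
  σ-1 rewrite transpose-target [ 0 ] [ 1 ] | transpose-source [ 0 ] [ 1 + h ] =
    transpose-other ([]-≢ 1+h<N 2<N λ ()) ([]-≢ 1+h<N 2+h<N λ ())

  σ-2 : σ [ 2 ] ≡ [ 2 + h ]
  σ-2 rewrite transpose-other ([]-≢ 2<N 0<N λ ()) ([]-≢ 2<N 1<N λ ())
            | transpose-other ([]-≢ 2<N 0<N λ ()) ([]-≢ 2<N 1+h<N λ ()) =
    transpose-source [ 2 ] [ 2 + h ]

  σ-0 : σ [ 0 ] ≡ [ 1 ]
  σ-0 rewrite transpose-source [ 0 ] [ 1 ]
            | transpose-other ([]-≢ 1<N 0<N λ ()) ([]-≢ 1<N 1+h<N λ ()) =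
    transpose-other ([]-≢ 1<N 2<N λ ()) ([]-≢ 1<N 2+h<N λ ())

  σ-1+h : σ [ 1 + h ] ≡ [ 0 ]
  σ-1+h rewrite transpose-other ([]-≢ 1+h<N 0<N λ ()) ([]-≢ 1+h<N 1<N λ ())
              | transpose-target [ 0 ] [ 1 + h ] =
    transpose-other ([]-≢ 0<N 2<N λ ()) ([]-≢ 0<N 2+h<N λ ())

  σ-2+h : σ [ 2 + h ] ≡ [ 2 ]
  σ-2+h rewrite transpose-other ([]-≢ 2+h<N 0<N λ ()) ([]-≢ 2+h<N 1<N λ ())
              | transpose-other ([]-≢ 2+h<N 0<N λ ()) ([]-≢ 2+h<N 1+h<N λ ()) =
    transpose-target [ 2 ] [ 2 + h ]

  σ-other : ∀ {a} → 2 < a → a < N → a ≢ 1 + h → a ≢ 2 + h → σ [ a ] ≡ [ a ]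
  σ-other {a} 2<a a<N a≢1+h a≢2+h = trans
    (cong (transpose [ 2 ] [ 2 + h ]) (trans
      (cong (transpose [ 0 ] [ 1 + h ])
        (transpose-other ([]-≢ a<N 0<N a≢0) ([]-≢ a<N 1<N a≢1)))
      (transpose-other ([]-≢ a<N 0<N a≢0) ([]-≢ a<N 1+h<N a≢1+h))))
    (transpose-other ([]-≢ a<N 2<N a≢2) ([]-≢ a<N 2+h<N a≢2+h))
    where
    a≢2 : a ≢ 2
    a≢2 refl = ℕ.<-irrefl refl 2<a
    a≢1 : a ≢ 1
    a≢1 refl = contradiction 2<a λ { (s≤s ()) }
    a≢0 : a ≢ 0
    a≢0 refl = contradiction 2<a λ ()

  ρ : Fin N → Fin N
  ρ x = σ (x ⊕ 1)

  ρ-injective : Injective _≡_ _≡_ ρ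
  ρ-injective = ⊕-cancelʳ 1 (s≤s z≤n) ∘ σ-injective

  -- `zero` is the new vertex and `suc zero` is ∞. The path starts at 3 + h, the one residue that is
  -- not the head of an arc from a residue, and it ends at ∞.
  transversal : Fin (2 + N) → Fin (2 + N)
  transversal zero          = suc (suc [ 3 + h ])
  transversal (suc zero)    = zero
  transversal (suc (suc x)) = suc (zigzag (ρ x) (suc x))

  vertex : ℕ → Fin (2 + N)
  vertex a = suc (suc [ a ])

  wrap : ∀ {a b} → a ≡ b + N → [ a ] ≡ [ b ]
  wrap {b = b} eq = trans (cong [_] eq) ([+N] b)

  module _ {a c} (σ≡ : σ [ 1 + a ] ≡ [ c ]) where

    ρ≡ : ρ [ a ] ≡ [ c ]
    ρ≡ = trans (cong σ (trans ([]⊕ a 1) (cong [_] (ℕ.+-comm a 1)))) σ≡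

    -- The tail `a` is located at position `y` of zigzag `c`, where the zigzag lemmas apply.
    arc-via : ∀ {y v} → [ c + y ] ≡ [ a ] →
              zigzag [ c ] (suc ([ c ] ⊕ y)) ≡ v → transversal (vertex a) ≡ suc v
    arc-via {y} c+y≡a eq = cong suc (trans
      (cong₂ (λ r x → zigzag r (suc x)) ρ≡ (trans (sym c+y≡a) (sym ([]⊕ c y)))) eq)

    low-arc : ∀ {b y z} → [ c + y ] ≡ [ a ] → y < h → y + suc z ≡ N → [ c + z ] ≡ [ b ] →
              transversal (vertex a) ≡ vertex b
    low-arc {z = z} c+y≡a y<h y+1+z≡N c+z≡b = arc-via c+y≡a
      (trans (zigzag-low [ c ] y<h y+1+z≡N) (cong suc (trans ([]⊕ c z) c+z≡b)))

    high-arc : ∀ {b y z} → [ c + y ] ≡ [ a ] → h < y → y < N → y + z ≡ N → [ c + z ] ≡ [ b ] →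
               transversal (vertex a) ≡ vertex b
    high-arc {z = z} c+y≡a h<y y<N y+z≡N c+z≡b = arc-via c+y≡a
      (trans (zigzag-high [ c ] h<y y<N y+z≡N) (cong suc (trans ([]⊕ c z) c+z≡b)))

  -- The exceptional arcs 0 → 1, 1 → 2 and h + 1 → h + 2 are each the arc from position h - 1 to
  -- position h in their zigzag.
  pred-h : ℕ
  pred-h = 2 + k

  pred-h+1+h≡N : pred-h + suc h ≡ N
  pred-h+1+h≡N = ℕ.+-suc pred-h h

  transversal-h : transversal (vertex h) ≡ suc zero
  transversal-h = arc-via σ-1+h refl (zigzag-mid [ 0 ])

  transversal-0 : transversal (vertex 0) ≡ vertex 1
  transversal-0 = low-arc σ-1 (wrap (eq k)) ℕ.≤-refl pred-h+1+h≡N (wrap {b = 1} refl)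
    where
    eq : ∀ k → 1 + (3 + k) + (2 + k) ≡ 0 + ((3 + k) + (3 + k))
    eq = solve-∀

  transversal-1 : transversal (vertex 1) ≡ vertex 2
  transversal-1 = low-arc σ-2 (wrap (eq k)) ℕ.≤-refl pred-h+1+h≡N (wrap {b = 2} refl)
    where
    eq : ∀ k → 2 + (3 + k) + (2 + k) ≡ 1 + ((3 + k) + (3 + k))
    eq = solve-∀

  transversal-1+h : transversal (vertex (1 + h)) ≡ vertex (2 + h)
  transversal-1+h = low-arc σ-2+h refl ℕ.≤-refl pred-h+1+h≡N refl

  N-1 : ℕ
  N-1 = pred-h + h

  h<N-1 : h < N-1
  h<N-1 = ℕ.m<n+m h {pred-h} (s≤s z≤n)

  transversal-N-1 : transversal (vertex N-1) ≡ vertex 3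
  -- The tail -1 has position N - 2 in zigzag 1, and the high arc leads from there to position 2.
  transversal-N-1 = high-arc (trans (cong σ (wrap {b = 0} refl)) σ-0) {y = 1 + k + h} refl
    (ℕ.m<n+m h (s≤s z≤n)) (ℕ.≤-trans (ℕ.n≤1+n _) ℕ.≤-refl) (eq k) refl
    where
    eq : ∀ k → 1 + k + (3 + k) + 2 ≡ (3 + k) + (3 + k)
    eq = solve-∀

  transversal-other : ∀ {a} → 2 ≤ a → suc a < N → a ≢ h → a ≢ 1 + h →
                      transversal (vertex a) ≡ vertex (2 + a)
  -- Relative to zigzag a + 1, the arc goes from position N - 1 to position 1.
  transversal-other {a} 2≤a 1+a<N a≢h a≢1+h = high-arc
    (σ-other (s≤s 2≤a) 1+a<N (a≢h ∘ ℕ.suc-injective) (a≢1+h ∘ ℕ.suc-injective))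
    (wrap (eq a k)) h<N-1 ℕ.≤-refl (ℕ.+-comm N-1 1) (cong [_] (ℕ.+-comm (1 + a) 1))
    where
    eq : ∀ a k → 1 + a + (2 + k + (3 + k)) ≡ a + ((3 + k) + (3 + k))
    eq = solve-∀

  Reached : Fin (2 + N) → Set
  Reached x = transversal ⊢ zero ↝ x

  infixl 5 _then_
  _then_ : ∀ {x y} → Reached x → transversal x ≡ y → Reached y
  r then eq = r ◅◅ eq ◅ ε

  +-suc-suc : ∀ a j → 2 + (a + (j + j)) ≡ a + (suc j + suc j)
  +-suc-suc = solve-∀

  -- `P` stands for an upper bound on the end of the run. Being inherited downwards in steps of 2,
  -- it holds at every stop and there rules out the exceptional tails.
  run : ∀ {a} j (P : ℕ → Set) → (∀ {c} → P (2 + c) → P c) →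
        (∀ {c} → a ≤ c → P (2 + c) → transversal (vertex c) ≡ vertex (2 + c)) →
        P (a + (j + j)) → Reached (vertex a) → Reached (vertex (a + (j + j)))
  run {a} zero    P down step _ reached = subst (Reached ∘ vertex) (sym (ℕ.+-identityʳ a)) reached
  run {a} (suc j) P down step Pend reached = subst (Reached ∘ vertex) (+-suc-suc a j)
    (run j P down step (down Pend′) reached then step (ℕ.m≤m+n a (j + j)) Pend′)
    where Pend′ = subst P (sym (+-suc-suc a j)) Pend

  run-low : ∀ {a} j → 2 ≤ a → a + (j + j) ≤ 1 + h →
            Reached (vertex a) → Reached (vertex (a + (j + j)))
  run-low j 2≤a = run j (_≤ 1 + h) (λ p → ℕ.≤-trans (ℕ.m≤n+m _ 2) p)
    λ { a≤c (s≤s c<h) → transversal-other (ℕ.≤-trans 2≤a a≤c) (ℕ.≤-<-trans c<h h<N)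
      (ℕ.<⇒≢ c<h) (ℕ.<⇒≢ (ℕ.m<n⇒m<1+n c<h)) }

  -- The bound is `N` and not N - 1, so that a run may end at 0 in the guise of `N`; a tail N - 1
  -- would overshoot it.
  run-high : ∀ {a} j → 2 + h ≤ a → a + (j + j) ≤ N →
             Reached (vertex a) → Reached (vertex (a + (j + j)))
  run-high j 2+h≤a = run j (_≤ N) (λ p → ℕ.≤-trans (ℕ.m≤n+m _ 2) p)
    λ a≤c 2+c≤N → let 2+h≤c = ℕ.≤-trans 2+h≤a a≤c in
      transversal-other (ℕ.≤-trans (s≤s (s≤s z≤n)) 2+h≤c) 2+c≤N
        (ℕ.>⇒≢ (ℕ.<⇒≤ 2+h≤c)) (ℕ.>⇒≢ 2+h≤c)

  -- The transversal consists of runs of steps +2, through 2, …, h+1 and through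
  -- h+2, …, N, joined by the exceptional arcs in an order depending on the
  -- parity of h.
  record Milestones : Set where
    field
      at-0   : Reached (vertex 0)
      at-2   : Reached (vertex 2)
      at-3   : Reached (vertex 3)
      at-2+h : Reached (vertex (2 + h))
      at-∞   : Reached (suc zero)

  at-3+h : Reached (vertex (3 + h))
  at-3+h = refl ◅ ε

  0≡N : vertex N ≡ vertex 0
  0≡N = cong (λ x → suc (suc x)) (wrap {N} {0} refl)

  run-low-to : ∀ {a b} j → 2 ≤ a → b ≤ 1 + h → a + (j + j) ≡ b →
    Reached (vertex a) → Reached (vertex b)
  run-low-to j 2≤a b≤1+h refl = run-low j 2≤a b≤1+h

  run-high-to : ∀ {a b} j → 2 + h ≤ a → b ≤ N → a + (j + j) ≡ b →
    Reached (vertex a) → Reached (vertex b)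
  run-high-to j 2+h≤a b≤N refl = run-high j 2+h≤a b≤N

  -- Here h = 4 + 2e is even, and the path is 3+h, ..., N-1, then 3, ..., 1+h, then 2+h, ..., N = 0,
  -- then 1, then 2, ..., h, ∞.
  milestones-even : ∀ e → k ≡ suc (e + e) → Milestones
  milestones-even e refl = record
    { at-0 = at-0 ; at-2 = at-2 ; at-3 = at-3 ; at-2+h = at-2+h ; at-∞ = at-h then transversal-h }
    where
    eq₁ : ∀ e → 3 + (4 + (e + e)) + (e + e) ≡ 2 + suc (e + e) + (4 + (e + e))
    eq₁ = solve-∀
    eq₂ : ∀ e → 3 + (suc e + suc e) ≡ 5 + (e + e)
    eq₂ = solve-∀
    eq₃ : ∀ e → 2 + (4 + (e + e)) + (suc e + suc e) ≡ (4 + (e + e)) + (4 + (e + e))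
    eq₃ = solve-∀
    eq₄ : ∀ e → 2 + (suc e + suc e) ≡ 4 + (e + e)
    eq₄ = solve-∀
    at-3   = run-high-to e (ℕ.n≤1+n _) (ℕ.n≤1+n _) (eq₁ e) at-3+h then transversal-N-1
    at-2+h = run-low-to (suc e) (ℕ.n≤1+n 2) ℕ.≤-refl (eq₂ e) at-3 then transversal-1+h
    at-0   = subst Reached 0≡N (run-high-to (suc e) ℕ.≤-refl ℕ.≤-refl (eq₃ e) at-2+h)
    at-2   = at-0 then transversal-0 then transversal-1
    at-h   = run-low-to (suc e) ℕ.≤-refl (ℕ.n≤1+n _) (eq₄ e) at-2

  -- Here h = 3 + 2e is odd, and the path is 3+h, ..., N = 0, then 1, then 2, ..., 1+h, then 2+h,
  -- ..., N-1, then 3, ..., h, ∞.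
  milestones-odd : ∀ e → k ≡ e + e → Milestones
  milestones-odd e refl = record
    { at-0 = at-0 ; at-2 = at-2 ; at-3 = at-3 ; at-2+h = at-2+h ; at-∞ = at-h then transversal-h }
    where
    eq₁ : ∀ e → 3 + (3 + (e + e)) + (e + e) ≡ (3 + (e + e)) + (3 + (e + e))
    eq₁ = solve-∀
    eq₂ : ∀ e → 2 + (suc e + suc e) ≡ 4 + (e + e)
    eq₂ = solve-∀
    eq₃ : ∀ e → 2 + (3 + (e + e)) + (e + e) ≡ 2 + (e + e) + (3 + (e + e))
    eq₃ = solve-∀
    at-0   = subst Reached 0≡N (run-high-to e (ℕ.n≤1+n _) ℕ.≤-refl (eq₁ e) at-3+h)
    at-2   = at-0 then transversal-0 then transversal-1
    at-2+h = run-low-to (suc e) ℕ.≤-refl ℕ.≤-refl (eq₂ e) at-2 then transversal-1+h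
    at-3   = run-high-to e ℕ.≤-refl (ℕ.n≤1+n _) (eq₃ e) at-2+h then transversal-N-1
    at-h   = run-low-to e (ℕ.n≤1+n 2) (ℕ.n≤1+n _) refl at-3

  milestones : Milestones
  milestones with parity k
  ... | e , inj₁ eq = milestones-odd e eq
  ... | e , inj₂ eq = milestones-even e eq

  open Milestones milestones

  -- Parity decides which of the two runs, from 2 or from 3, passes through the residue.
  -- `reach-high` does the same with 2 + h and 3 + h.
  reach-low : ∀ w → 2 + w ≤ 1 + h → Reached (vertex (2 + w))
  reach-low w ≤1+h with parity w
  ... | j , inj₁ refl = run-low j ℕ.≤-refl ≤1+h at-2
  ... | j , inj₂ refl = run-low j (ℕ.n≤1+n 2) ≤1+h at-3

  reach-high : ∀ w → 2 + h + w ≤ N → Reached (vertex (2 + h + w))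
  reach-high w ≤N with parity w
  ... | j , inj₁ refl = run-high j ℕ.≤-refl ≤N at-2+h
  ... | j , inj₂ refl = run-high-to j (ℕ.n≤1+n _) ≤N (sym (ℕ.+-suc (2 + h) (j + j))) at-3+h

  reach-vertex : ∀ a → a < N → Reached (vertex a)
  reach-vertex zero          _   = at-0
  reach-vertex (suc zero)    _   = at-0 then transversal-0
  reach-vertex (suc (suc w)) a<N with 2 + w ℕ.≤? 1 + h
  ... | yes ≤1+h = reach-low w ≤1+h
  ... | no  ≰1+h = subst (Reached ∘ vertex) 2+h+u≡
    (reach-high u (subst (_≤ N) (sym 2+h+u≡) (ℕ.<⇒≤ a<N)))
    where
    u = 2 + w ∸ (2 + h)
    2+h+u≡ : 2 + h + u ≡ 2 + w
    2+h+u≡ = ℕ.m+[n∸m]≡n (ℕ.≰⇒> ≰1+h)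

  transversal-cyclic : Cyclic transversal
  transversal-cyclic = reachable⇒cyclic transversal zero (suc zero) refl reach
    where
    reach : ∀ x → Reached x
    reach zero          = ε
    reach (suc zero)    = at-∞
    reach (suc (suc x)) = subst (λ z → Reached (suc (suc z))) ([toℕ] x)
      (reach-vertex (toℕ x) (Fin.toℕ<n x))

  tail-or-last : ∀ v → (∃[ x ] suc x ≡ v) ⊎ transversal (suc v) ≡ zero
  tail-or-last zero    = inj₂ refl
  tail-or-last (suc x) = inj₁ (x , refl)

  -- Every residue is the tail of a removed arc, and ∞ is the last vertex. The transversal follows
  -- zigzag `ρ x` at `x` by definition, whence `refl`.
  open Extend zigzags suc Fin.suc-injective ρ ρ-injective
    transversal transversal-cyclic (λ _ → refl) tail-or-last public
    using (extendedCycles)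

-- Pairs of terminals in the cocktail party digraph

∣pair∣≡2 : (S : Subset n) → ∣ S ∣ ≡ 2 →
           ∃[ x ] ∃[ y ] x ≢ y × x ∈ S × y ∈ S × (∀ {v} → v ∈ S → v ≡ x ⊎ v ≡ y)
∣pair∣≡2 S eq
  with x , x∈S ← enum S (subst Fin (sym eq) zero) , enum-∈ S (subst Fin (sym eq) zero)
  with y , y∈S , x≢y ← anotherMember S (ℕ.≤-reflexive (sym eq)) x = x , y , x≢y , x∈S , y∈S , only
  where
  only : ∀ {v} → v ∈ S → v ≡ x ⊎ v ≡ y
  only {v} v∈S with v Fin.≟ x | v Fin.≟ y
  ... | yes v≡x | _       = inj₁ v≡x
  ... | no  _   | yes v≡y = inj₂ v≡y
  -- A third member `v` would survive the removal of `x` and `y`, making `S` too large.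
  ... | no  v≢x | no  v≢y = contradiction (ℕ.≤-trans (s≤s (ℕ.≤-trans (s≤s (ℕ.≤-trans (s≤s z≤n)
    (x∈p⇒∣p-x∣<∣p∣ (x∈p∧x≢y⇒x∈p-y (x∈p∧x≢y⇒x∈p-y v∈S v≢x) v≢y))))
    (x∈p⇒∣p-x∣<∣p∣ (x∈p∧x≢y⇒x∈p-y y∈S (x≢y ∘ sym))))) (x∈p⇒∣p-x∣<∣p∣ x∈S))
    (ℕ.<⇒≱ (s≤s (ℕ.≤-reflexive eq)))

-- The perfect matching {0,1}, {2,3}, ...; the order `q * 2` is the form in which `divides` presents
-- an even number.
partner : ∀ q → Fin (q * 2) → Fin (q * 2)
partner (suc q) zero          = suc zero
partner (suc q) (suc zero)    = zero
partner (suc q) (suc (suc x)) = suc (suc (partner q x))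

partner-involutive : ∀ q x → partner q (partner q x) ≡ x
partner-involutive (suc q) zero          = refl
partner-involutive (suc q) (suc zero)    = refl
partner-involutive (suc q) (suc (suc x)) = cong (λ y → suc (suc y)) (partner-involutive q x)

partner-≢ : ∀ q x → x ≢ partner q x
partner-≢ (suc q) (suc (suc x)) eq = partner-≢ q x (Fin.suc-injective (Fin.suc-injective eq))

module CocktailParty
  (m : ℕ) (_′ : Fin (2 + m) → Fin (2 + m)) (′-involutive : ∀ x → (x ′) ′ ≡ x) (′-≢ : ∀ x → x ≢ x ′)
  where

  Vertex : Set
  Vertex = Fin (2 + m)

  Adjacent : Vertex → Vertex → Set
  Adjacent x y = x ≢ y × y ≢ x ′

  adjacent? : ∀ x → Decidable (Adjacent x)
  adjacent? x y = ¬? (x Fin.≟ y) ×-dec ¬? (y Fin.≟ x ′)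

  ′-swap : ∀ {x y} → x ≡ y ′ → y ≡ x ′
  ′-swap {x} {y} eq = trans (sym (′-involutive y)) (cong _′ (sym eq))

  party : Digraph (2 + m)
  party = record
    { out      = λ x → ⟦ adjacent? x ⟧
    ; loopless = λ x x∈ → proj₁ (∈⟦⟧⁻ (adjacent? x) x∈) refl
    }

  outDegree≤ : ∀ x → ∣ out party x ∣ ≤ m
  outDegree≤ x = s≤s⁻¹ (s≤s⁻¹ (begin
    2 + ∣ out party x ∣        ≤⟨ ℕ.+-monoʳ-≤ 2 (p⊆q⇒∣p∣≤∣q∣ neighbours⊆) ⟩
    2 + ∣ ⊤ - x - (x ′) ∣      ≤⟨ s≤s (x∈p⇒∣p-x∣<∣p∣ (x∈p∧x≢y⇒x∈p-y ∈⊤ (′-≢ x ∘ sym))) ⟩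
    1 + ∣ ⊤ - x ∣              ≤⟨ x∈p⇒∣p-x∣<∣p∣ (∈⊤ {x = x}) ⟩
    ∣ ⊤ {2 + m} ∣              ≡⟨ ∣⊤∣≡n (2 + m) ⟩
    2 + m                      ∎))
    where
    open ℕ.≤-Reasoning
    neighbours⊆ : out party x ⊆ ⊤ - x - (x ′)
    neighbours⊆ y∈ with x≢y , y≢x′ ← ∈⟦⟧⁻ (adjacent? x) y∈ =
      x∈p∧x≢y⇒x∈p-y (x∈p∧x≢y⇒x∈p-y ∈⊤ (x≢y ∘ sym)) y≢x′

  -- Enumerates the vertices other than `x` and `x ′`: the inner `punchIn` skips `x ′` as numbered
  -- once `x` has been removed.
  neighbour : Vertex → Fin m → Vertex
  neighbour x i = punchIn x (punchIn (punchOut (′-≢ x)) i)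

  neighbour-adjacent : ∀ x i → Adjacent x (neighbour x i)
  neighbour-adjacent x i = Fin.punchInᵢ≢i x _ ∘ sym , λ eq →
    Fin.punchInᵢ≢i (punchOut (′-≢ x)) i
      (Fin.punchIn-injective x _ _ (trans eq (sym (Fin.punchIn-punchOut (′-≢ x)))))

  neighbour-injective : ∀ x → Injective _≡_ _≡_ (neighbour x)
  neighbour-injective x = Fin.punchIn-injective (punchOut (′-≢ x)) _ _ ∘ Fin.punchIn-injective x _ _

  -- The connection of x and y through a neighbour z of x is the path x z y,
  -- except for z = y (the path x y) and for z = y ′, where z y is not an edge
  -- and the path is x y′ x′ y. In each case it has the form x z w y.
  module _ {x y : Vertex} (x≢y : x ≢ y) where

    bypass : Vertex → Vertex
    bypass z with z Fin.≟ y ′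
    ... | yes _ = x ′
    ... | no  _ = z

    bypass-cases : ∀ z → (z ≡ y ′ × bypass z ≡ x ′) ⊎ (z ≢ y ′ × bypass z ≡ z)
    bypass-cases z with z Fin.≟ y ′
    ... | yes z≡y′ = inj₁ (z≡y′ , refl)
    ... | no  z≢y′ = inj₂ (z≢y′ , refl)

    module Connection (z : Vertex) (xz : Adjacent x z) where

      w : Vertex
      w = bypass z

      Interior : Vertex → Set
      Interior v = v ≡ z ⊎ v ≡ w

      OnPath : Vertex → Set
      OnPath v = (v ≡ x ⊎ v ≡ y) ⊎ Interior v

      onPath? : Decidable OnPath
      onPath? v = (v Fin.≟ x ⊎-dec v Fin.≟ y) ⊎-dec (v Fin.≟ z ⊎-dec v Fin.≟ w)

      Link : Vertex → Vertex → Set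
      Link u v = (u ≡ x × v ≡ z) ⊎ (u ≡ z × v ≡ w) ⊎ (u ≡ w × v ≡ y)

      link? : ∀ u v → Dec (Link u v)
      link? u v = (u Fin.≟ x ×-dec v Fin.≟ z) ⊎-dec (u Fin.≟ z ×-dec v Fin.≟ w) ⊎-dec
                  (u Fin.≟ w ×-dec v Fin.≟ y)

      -- Paths with w = z or w = y contain degenerate links, which `u ≢ v` discards. Links count in
      -- both directions, so that a path becomes a strong subgraph.
      Edge : Vertex → Vertex → Set
      Edge u v = u ≢ v × (Link u v ⊎ Link v u)

      edge? : ∀ u → Decidable (Edge u)
      edge? u v = ¬? (u Fin.≟ v) ×-dec (link? u v ⊎-dec link? v u)

      -- If the detour is taken, then w = x ′: w = z ′ would give z = x, and y = w ′ would give y =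
      -- x. Otherwise w = z and z ≢ y ′.
      link-adjacent : ∀ {u v} → u ≢ v → Link u v → v ≢ u ′
      link-adjacent u≢v (inj₁ (refl , refl)) = proj₂ xz
      link-adjacent u≢v (inj₂ (inj₁ (refl , refl))) w≡z′ with bypass-cases z
      ... | inj₂ (_ , w≡z)      = u≢v (sym w≡z)
      ... | inj₁ (z≡y′ , w≡x′) = proj₁ xz (trans (′-swap w≡x′)
        (trans (cong _′ w≡z′) (′-involutive z)))
      link-adjacent u≢v (inj₂ (inj₂ (refl , refl))) y≡w′ with bypass-cases z
      ... | inj₂ (z≢y′ , w≡z)  = z≢y′ (trans (sym w≡z) (′-swap y≡w′))
      ... | inj₁ (_ , w≡x′)    = x≢y (trans (′-swap w≡x′) (sym y≡w′))

      edge-adjacent : ∀ {u v} → Edge u v → Adjacent u v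
      edge-adjacent (u≢v , inj₁ uv) = u≢v , link-adjacent u≢v uv
      edge-adjacent (u≢v , inj₂ vu) = u≢v , link-adjacent (u≢v ∘ sym) vu ∘ ′-swap

      edge-sym : ∀ {u v} → Edge u v → Edge v u
      edge-sym (u≢v , links) = u≢v ∘ sym , swap links

      -- Even the direct path from `x` to `y` qualifies, as there `y` itself plays the part of `z`.
      -- Arcs of different connections will be told apart by their interior ends.
      link-interior : ∀ {u v} → Link u v → Interior u ⊎ Interior v
      link-interior (inj₁ (_ , v≡z))        = inj₂ (inj₁ v≡z)
      link-interior (inj₂ (inj₁ (u≡z , _))) = inj₁ (inj₁ u≡z)
      link-interior (inj₂ (inj₂ (u≡w , _))) = inj₁ (inj₂ u≡w)

      edge-interior : ∀ {u v} → Edge u v → Interior u ⊎ Interior v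
      edge-interior (_ , inj₁ uv) = link-interior uv
      edge-interior (_ , inj₂ vu) = swap (link-interior vu)

      edge-tail : ∀ {u v} → Edge u v → OnPath u
      edge-tail (_ , inj₁ (inj₁ (u≡x , _)))        = inj₁ (inj₁ u≡x)
      edge-tail (_ , inj₁ (inj₂ (inj₁ (u≡z , _)))) = inj₂ (inj₁ u≡z)
      edge-tail (_ , inj₁ (inj₂ (inj₂ (u≡w , _)))) = inj₂ (inj₂ u≡w)
      edge-tail (_ , inj₂ (inj₁ (_ , u≡z)))        = inj₂ (inj₁ u≡z)
      edge-tail (_ , inj₂ (inj₂ (inj₁ (_ , u≡w)))) = inj₂ (inj₂ u≡w)
      edge-tail (_ , inj₂ (inj₂ (inj₂ (_ , u≡y)))) = inj₁ (inj₂ u≡y)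

      x-notInterior : ¬ Interior x
      x-notInterior (inj₁ x≡z) = proj₁ xz x≡z
      x-notInterior (inj₂ x≡w) with bypass-cases z
      ... | inj₁ (_ , w≡x′) = ′-≢ x (trans x≡w w≡x′)
      ... | inj₂ (_ , w≡z)  = proj₁ xz (trans x≡w w≡z)

      connection : Subgraph party
      connection = record
        { V     = ⟦ onPath? ⟧
        ; A     = λ u → ⟦ edge? u ⟧
        ; arc   = λ {u} → ∈⟦⟧⁺ (adjacent? u) ∘ edge-adjacent ∘ ∈⟦⟧⁻ (edge? u)
        ; tail∈ = λ {u} → ∈⟦⟧⁺ onPath? ∘ edge-tail ∘ ∈⟦⟧⁻ (edge? u)
        ; head∈ = λ {u} → ∈⟦⟧⁺ onPath? ∘ edge-tail ∘ edge-sym ∘ ∈⟦⟧⁻ (edge? u)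
        }

      connection-strong : Strong connection
      connection-strong u∈ v∈ = Star.map (∈⟦⟧⁺ (edge? _))
        (Star.reverse edge-sym (fromx (∈⟦⟧⁻ onPath? u∈)) ◅◅ fromx (∈⟦⟧⁻ onPath? v∈))
        where
        along : ∀ {u v} → Link u v → Star Edge u v
        along {u} {v} uv with u Fin.≟ v
        ... | yes refl = ε
        ... | no  u≢v  = (u≢v , inj₁ uv) ◅ ε
        toz : Star Edge x z
        toz = along (inj₁ (refl , refl))
        tow : Star Edge x w
        tow = toz ◅◅ along (inj₂ (inj₁ (refl , refl)))
        fromx : ∀ {v} → OnPath v → Star Edge x v
        fromx (inj₁ (inj₁ refl)) = ε
        fromx (inj₁ (inj₂ refl)) = tow ◅◅ along (inj₂ (inj₂ (refl , refl)))
        fromx (inj₂ (inj₁ refl)) = toz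
        fromx (inj₂ (inj₂ refl)) = tow

    open Connection

    -- Interior vertices are `z` and possibly `x ′`. The latter is no neighbour of `x`, so it is
    -- never another connection's `z`, and it is used only when z = y ′.
    interior-unique : ∀ {z z₁ xz xz₁ v} → Interior z xz v → Interior z₁ xz₁ v → z ≡ z₁
    interior-unique (inj₁ v≡z) (inj₁ v≡z₁) = trans (sym v≡z) v≡z₁
    interior-unique {z} {z₁} {xz} (inj₁ v≡z) (inj₂ v≡w₁) with bypass-cases z₁
    ... | inj₁ (_ , w₁≡x′) = contradiction (trans (sym v≡z) (trans v≡w₁ w₁≡x′)) (proj₂ xz)
    ... | inj₂ (_ , w₁≡z₁) = trans (sym v≡z) (trans v≡w₁ w₁≡z₁)
    interior-unique {z} {z₁} {xz} {xz₁} (inj₂ v≡w) (inj₁ v≡z₁) =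
      sym (interior-unique {z₁} {z} {xz₁} {xz} (inj₁ v≡z₁) (inj₂ v≡w))
    interior-unique {z} {z₁} {xz} {xz₁} (inj₂ v≡w) (inj₂ v≡w₁) with bypass-cases z | bypass-cases z₁
    ... | inj₁ (z≡y′ , _) | inj₁ (z₁≡y′ , _) = trans z≡y′ (sym z₁≡y′)
    ... | inj₂ (_ , w≡z)  | _ =
      interior-unique {z} {z₁} {xz} {xz₁} (inj₁ (trans v≡w w≡z)) (inj₂ v≡w₁)
    ... | _ | inj₂ (_ , w₁≡z₁) =
      sym (interior-unique {z₁} {z} {xz₁} {xz} (inj₁ (trans v≡w₁ w₁≡z₁)) (inj₂ v≡w))

    packing : (S : Subset (2 + m)) → x ∈ S → y ∈ S →
              (∀ {v} → v ∈ S → v ≡ x ⊎ v ≡ y) → Packing party S m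
    packing S x∈S y∈S only = record
      { member   = λ i → connection (neighbour x i) (neighbour-adjacent x i)
      ; strong   = λ i → connection-strong (neighbour x i) (neighbour-adjacent x i)
      ; contains = λ i → S⊆path i
      ; disjoint = λ i j i<j → ⊆-antisym (meet⊆S i j i<j)
          (λ v∈S → x∈p∩q⁺ (S⊆path i v∈S , S⊆path j v∈S)) , noCommonArc i j i<j
      }
      where
      adj = neighbour-adjacent x
      member : Fin m → Subgraph party
      member i = connection (neighbour x i) (adj i)
      S⊆path : ∀ i → S ⊆ V (member i)
      S⊆path i v∈S = ∈⟦⟧⁺ (onPath? _ (adj i)) (inj₁ (only v∈S))
      interiors-disjoint : ∀ i j → i Fin.< j → ∀ {v} → Interior _ (adj i) v → ¬ Interior _ (adj j) v
      interiors-disjoint i j i<j vi vj =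
        Fin.<⇒≢ i<j (neighbour-injective x (interior-unique {xz = adj i} {adj j} vi vj))
      meet : ∀ i j → i Fin.< j → ∀ {v} → OnPath _ (adj i) v → OnPath _ (adj j) v → v ≡ x ⊎ v ≡ y
      meet i j i<j (inj₁ v∈) _         = v∈
      meet i j i<j (inj₂ _)  (inj₁ v∈) = v∈
      meet i j i<j (inj₂ vi) (inj₂ vj) = contradiction vj (interiors-disjoint i j i<j vi)
      meet⊆S : ∀ i j → i Fin.< j → V (member i) ∩ V (member j) ⊆ S
      meet⊆S i j i<j v∈ with vi , vj ← x∈p∩q⁻ _ _ v∈
        with meet i j i<j (∈⟦⟧⁻ (onPath? _ (adj i)) vi) (∈⟦⟧⁻ (onPath? _ (adj j)) vj)
      ... | inj₁ refl = x∈S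
      ... | inj₂ refl = y∈S
      y-interior : ∀ i {u v} → u ≡ x ⊎ u ≡ y → v ≡ x ⊎ v ≡ y →
                   Edge _ (adj i) u v → Interior _ (adj i) y
      y-interior i u∈ v∈ uv = [ which u∈ , which v∈ ]′ (edge-interior _ (adj i) uv)
        where
        which : ∀ {u} → u ≡ x ⊎ u ≡ y → Interior _ (adj i) u → Interior _ (adj i) y
        which (inj₁ refl) int = contradiction int (x-notInterior _ (adj i))
        which (inj₂ refl) int = int
      -- A common arc would have both ends in {x, y} and an interior end in each connection. As `x`
      -- is never interior, `y` would be interior to both.
      noCommonArc : ∀ i j → i Fin.< j → ∀ u v → v ∈ A (member i) u → v ∉ A (member j) u
      noCommonArc i j i<j u v uvi∈ uvj∈ = interiors-disjoint i j i<j
        (y-interior i u∈ v∈ uvi) (y-interior j u∈ v∈ uvj)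
        where
        uvi = ∈⟦⟧⁻ (edge? _ (adj i) u) uvi∈
        uvj = ∈⟦⟧⁻ (edge? _ (adj j) u) uvj∈
        u∈ = meet i j i<j (edge-tail _ (adj i) uvi) (edge-tail _ (adj j) uvj)
        v∈ = meet i j i<j (edge-tail _ (adj i) (edge-sym _ (adj i) uvi))
                          (edge-tail _ (adj j) (edge-sym _ (adj j) uvj))

  f-party : f⟨ 2 + m , 2 , m ⟩≔ ((2 + m) * m)
  f-party = regular⇒f ℕ.≤-refl (s≤s (s≤s z≤n)) party outDegree≤ λ S ∣S∣≡2 →
    let x , y , x≢y , x∈S , y∈S , only = ∣pair∣≡2 S ∣S∣≡2 in packing x≢y S x∈S y∈S only

f-even : 2 ≤ n → 2 ∣ n → f⟨ n , 2 , n ∸ 2 ⟩≔ (n * (n ∸ 2))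
f-even (s≤s (s≤s _)) (divides (suc q) refl) =
  CocktailParty.f-party (q * 2) (partner (suc q)) (partner-involutive (suc q)) (partner-≢ (suc q))

-- Hamiltonian decompositions of all admissible orders, and the theorem

tillson : ∀ n → 2 ≤ n → n ≢ 2 → n ≢ 4 → n ≢ 6 → DisjointCycles n (n ∸ 1)
tillson n 2≤n n≢2 n≢4 n≢6 with parity n
... | suc j                       , inj₂ refl = Zigzag.zigzags j
... | 0                           , inj₁ refl = contradiction 2≤n λ ()
... | 0                           , inj₂ refl = contradiction 2≤n λ { (s≤s ()) }
... | 1                           , inj₁ refl = contradiction refl n≢2
... | 2                           , inj₁ refl = contradiction refl n≢4
... | 3                           , inj₁ refl = contradiction refl n≢6
... | suc (suc (suc (suc k)))     , inj₁ refl =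
  subst (λ a → DisjointCycles (suc a) a) (sym (ℕ.+-suc (3 + k) (3 + k)))
    (Transversal.extendedCycles k)

theorem3p7 : ∀ (n k ℓ : ℕ) → 2 ≤ k → k ≤ n →
    (∀ m → f⟨ n , k , ℓ ⟩≔ m → n * ℓ ≤ m) ×
    (ℓ ≡ 1 → f⟨ n , k , ℓ ⟩≔ n) ×
    (2 ≤ ℓ → ℓ ≤ n ∸ 1 → k ≡ n → n ≢ 4 → n ≢ 6 → f⟨ n , n , ℓ ⟩≔ (n * ℓ)) ×
    (2 ∣ n → ℓ ≡ n ∸ 2 → k ≡ 2 → f⟨ n , 2 , ℓ ⟩≔ (n * ℓ))
theorem3p7 n k ℓ 2≤k k≤n =
  (λ m → f-lowerBound 2≤k k≤n) ,
  (λ { refl → f-one 2≤k k≤n }) ,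
  -- Order 2 is excluded because it would require 2 ≤ ℓ ≤ 1.
  (λ 2≤ℓ ℓ≤n-1 _ n≢4 n≢6 → f-spanning 2≤n (takeCycles ℓ≤n-1
    (tillson n 2≤n (λ { refl → ℕ.<⇒≱ 2≤ℓ ℓ≤n-1 }) n≢4 n≢6))) ,
  (λ { 2∣n refl refl → f-even 2≤n 2∣n })
  where
  2≤n = ℕ.≤-trans 2≤k k≤n
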